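{- Let $G$ be a graph. Then \[M(G)-Z_{\mathrm{vc}}(G)\leq \xi(G).\]
   Context: Graphs are finite, simple and undirected; $\overline{G}$ is the complement of $G$, and a non-edge of $G$ is an edge of $\overline{G}$. $N_G(i)$ is the neighborhood of $i$ and $N_G[i]=N_G(i)\cup\{i\}$. Matrices. $\mathcal{S}(G)$ is the set of real symmetric matrices indexed by $V(G)$ whose $i,j$-entry, $i\neq j$, is nonzero if $i$ and $j$ are adjacent in $G$ and zero otherwise (diagonal entries are arbitrary real numbers). A symmetric matrix $A$ has the Strong Arnold Property (SAP) if $X=O$ is the only real symmetric matrix with $A\circ X=O$, $I\circ X=O$ and $AX=O$, where $\circ$ is the entrywise product. With $\mathrm{null}(A)$ the nullity of $A$, $M(G)=\max\{\mathrm{null}(A):A\in\mathcal{S}(G)\}$ and $\xi(G)=\max\{\mathrm{null}(A):A\in\mathcal{S}(G),\ A\text{ has the SAP}\}$. SAP color change rule. At every stage each non-edge of $G$ is blue or white. Let $B_E$ be the current set of blue non-edges. For a vertex $k$, let $N_{B_E}(k)=\{j:\{j,k\}\in B_E\}$. The local game at $k$ is the zero forcing game on $G$ in which the blue vertices are $\phi_k(G,B_E)=N_G[k]\cup N_{B_E}(k)$ and all other vertices are white; $i\rightarrow j$ in the local game at $k$ means that $i$ is blue, and $j$ is the only white neighbor of $i$ in $G$. The color change rule CCR-$Z_{\mathrm{SAP}}$ consists of: (1) (forcing triple) if $\{j,k\}$ is a white non-edge and $i\rightarrow j$ in the local game at $k$ for some vertex $i$, then $\{j,k\}$ turns blue;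 this is denoted $(k:i\rightarrow j)$; (2) (odd cycle rule) let $\overline{G}_W$ be the graph on $V(G)$ whose edges are the white non-edges; if for some vertex $i$ the induced subgraph $\overline{G}_W[N_G(i)]$ has a connected component that is an odd cycle $C$, then all non-edges on $C$ turn blue. The parameter $Z_{\mathrm{vc}}$. For $B\subseteq V(G)$ let $\overline{cl}(B)$ be the set of all non-edges of $G$ incident to at least one vertex of $B$. $Z_{\mathrm{vc}}(G)$ is the minimum cardinality of a set $B\subseteq V(G)$ such that, starting with exactly the non-edges in $\overline{cl}(B)$ blue, every non-edge becomes blue by repeated applications of CCR-$Z_{\mathrm{SAP}}$ with the restriction that $(k:i\rightarrow j)$ may not be used to perform a force if $i\in B$ and $\{i,k\}\in E(\overline{G})$. -}

module Defs where

open import Algebra.Bundles.Raw using (RawMonoid)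
import Algebra.Definitions.RawMonoid as RawSum
open import Data.Fin.Base using (Fin; toℕ)
open import Data.Fin.Properties using (_≟_)
open import Data.Fin.Subset using (Subset; _∈_; ∣_∣; Nonempty)
open import Data.Nat.Base as ℕ using (ℕ; suc)
import Data.Nat.Properties as ℕₚ
open import Data.Nat.Divisibility using (_∣_)
open import Data.Product.Base using (∃-syntax; Σ-syntax; _×_; _,_; proj₁; proj₂)
open import Data.Rational.Base as ℚ using (ℚ; 0ℚ; 1ℚ)
import Data.Rational.Properties as ℚₚ
open import Data.Rational.Solver using (module +-*-Solver)
open import Data.Sum.Base using (_⊎_; inj₁; inj₂)
open import Function.Base using (_∘_)
open import Function.Bundles using (_⇔_)
open import Function.Definitions using (Injective)
open import Level using (Level; 0ℓ)
open import Relation.Binary.Construct.Closure.ReflexiveTransitive using (Star)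
open import Relation.Binary.Core using (Rel)
import Relation.Binary.Definitions as B
open import Relation.Binary.PropositionalEquality using (_≡_; _≢_; refl; sym; trans; cong; cong₂; subst)
open import Relation.Nullary.Decidable using (yes; no; ¬?; _×-dec_)
open import Relation.Nullary.Negation.Core using (¬_)
open import Relation.Unary using (Pred)

private
  variable
    a : Level
    n k : ℕ

------------------------------------------------------------------------
-- Real numbers: Cauchy sequences of rationals, identified up to _≈_.

-- As ∃ is a Σ-type, a Cauchy sequence comes with a modulus of convergence.
-- Classically every Cauchy sequence has one, so ℝ / _≈_ is the field of reals.
IsCauchy : (ℕ → ℚ) → Set
IsCauchy f = ∀ ε → 0ℚ ℚ.< ε →
  ∃[ N ] ∀ m n → N ℕ.≤ m → N ℕ.≤ n → ℚ.∣ f m ℚ.- f n ∣ ℚ.< ε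

record ℝ : Set where
  constructor mkℝ
  field
    seq    : ℕ → ℚ
    cauchy : IsCauchy seq

open ℝ public

infix 4 _≈_
record _≈_ (x y : ℝ) : Set where
  constructor mk≈
  field
    close : ∀ ε → 0ℚ ℚ.< ε →
      ∃[ N ] ∀ n → N ℕ.≤ n → ℚ.∣ seq x n ℚ.- seq y n ∣ ℚ.< ε

open _≈_ public

private
  +-rearrange : ∀ a b c d → (a ℚ.+ b) ℚ.- (c ℚ.+ d) ≡ (a ℚ.- c) ℚ.+ (b ℚ.- d)
  +-rearrange = solve 4 (λ a b c d → (a :+ b) :- (c :+ d) := (a :- c) :+ (b :- d)) refl
    where open +-*-Solver

  +-add-back : ∀ a b → a ≡ (a ℚ.- b) ℚ.+ b
  +-add-back = solve 2 (λ a b → a := (a :- b) :+ b) refl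
    where open +-*-Solver

  *-rearrange : ∀ a b c d → a ℚ.* b ℚ.- c ℚ.* d ≡ a ℚ.* (b ℚ.- d) ℚ.+ d ℚ.* (a ℚ.- c)
  *-rearrange = solve 4 (λ a b c d → a :* b :- c :* d := a :* (b :- d) :+ d :* (a :- c)) refl
    where open +-*-Solver

  ∣+∣-bound : ∀ p q {r s} → ℚ.∣ p ∣ ℚ.< r → ℚ.∣ q ∣ ℚ.< s → ℚ.∣ p ℚ.+ q ∣ ℚ.< r ℚ.+ s
  ∣+∣-bound p q p<r q<s = ℚₚ.≤-<-trans (ℚₚ.∣p+q∣≤∣p∣+∣q∣ p q) (ℚₚ.+-mono-< p<r q<s)

  ∣*∣-bound : ∀ p q {r s} → 0ℚ ℚ.< r → ℚ.∣ p ∣ ℚ.< r → ℚ.∣ q ∣ ℚ.< s →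
              ℚ.∣ p ℚ.* q ∣ ℚ.< r ℚ.* s
  ∣*∣-bound p q {r} 0<r p<r q<s = subst (ℚ._< _) (sym (ℚₚ.∣p*q∣≡∣p∣*∣q∣ p q))
    (ℚₚ.≤-<-trans
      (ℚₚ.*-monoʳ-≤-nonNeg ℚ.∣ q ∣ {{ℚₚ.∣-∣-nonNeg q}} (ℚₚ.<⇒≤ p<r))
      (ℚₚ.*-monoʳ-<-pos r {{ℚ.positive 0<r}} q<s))

  divide : ∀ k ε → 0ℚ ℚ.< k → 0ℚ ℚ.< ε → ∃[ δ ] (0ℚ ℚ.< δ) × k ℚ.* δ ≡ ε
  divide k ε 0<k 0<ε = k⁻¹ ℚ.* ε , 0<k⁻¹ε , kk⁻¹ε≡ε
    where
    instance
      k-pos : ℚ.Positive k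
      k-pos = ℚ.positive 0<k
      k-nonZero : ℚ.NonZero k
      k-nonZero = ℚₚ.pos⇒nonZero k

    k⁻¹ : ℚ
    k⁻¹ = ℚ.1/ k

    0<k⁻¹ε : 0ℚ ℚ.< k⁻¹ ℚ.* ε
    0<k⁻¹ε = subst (ℚ._< k⁻¹ ℚ.* ε) (ℚₚ.*-zeroʳ k⁻¹)
      (ℚₚ.*-monoʳ-<-pos k⁻¹ {{ℚₚ.1/pos⇒pos k}} 0<ε)

    kk⁻¹ε≡ε : k ℚ.* (k⁻¹ ℚ.* ε) ≡ ε
    kk⁻¹ε≡ε = trans (sym (ℚₚ.*-assoc k k⁻¹ ε))
      (trans (cong (ℚ._* ε) (ℚₚ.*-inverseʳ k)) (ℚₚ.*-identityˡ ε))

  0<+ : ∀ r s → 0ℚ ℚ.< r → 0ℚ ℚ.< s → 0ℚ ℚ.< r ℚ.+ s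
  0<+ r s 0<r 0<s = ℚₚ.positive⁻¹ (r ℚ.+ s)
    {{ℚₚ.pos+pos⇒pos r {{ℚ.positive 0<r}} s {{ℚ.positive 0<s}}}}

  split : ∀ r s ε → 0ℚ ℚ.< r → 0ℚ ℚ.< s → 0ℚ ℚ.< ε →
          ∃[ δ ] (0ℚ ℚ.< δ) × r ℚ.* δ ℚ.+ s ℚ.* δ ≡ ε
  split r s ε 0<r 0<s 0<ε with divide (r ℚ.+ s) ε (0<+ r s 0<r 0<s) 0<ε
  ... | δ , 0<δ , eq = δ , 0<δ , trans (sym (ℚₚ.*-distribʳ-+ δ r s)) eq

  0<1 : 0ℚ ℚ.< 1ℚ
  0<1 = ℚₚ.positive⁻¹ 1ℚ

  *-near : ∀ {a b c d K₁ K₂ δ} → 0ℚ ℚ.< K₁ → 0ℚ ℚ.< K₂ →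
           ℚ.∣ a ∣ ℚ.< K₁ → ℚ.∣ d ∣ ℚ.< K₂ →
           ℚ.∣ a ℚ.- c ∣ ℚ.< δ → ℚ.∣ b ℚ.- d ∣ ℚ.< δ →
           ℚ.∣ a ℚ.* b ℚ.- c ℚ.* d ∣ ℚ.< K₁ ℚ.* δ ℚ.+ K₂ ℚ.* δ
  *-near {a} {b} {c} {d} 0<K₁ 0<K₂ a<K₁ d<K₂ ac<δ bd<δ =
    subst (λ q → ℚ.∣ q ∣ ℚ.< _) (sym (*-rearrange a b c d))
      (∣+∣-bound (a ℚ.* (b ℚ.- d)) (d ℚ.* (a ℚ.- c))
        (∣*∣-bound a (b ℚ.- d) 0<K₁ a<K₁ bd<δ)
        (∣*∣-bound d (a ℚ.- c) 0<K₂ d<K₂ ac<δ))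

abstract
  const-cauchy : ∀ q → IsCauchy (λ _ → q)
  const-cauchy q ε 0<ε = 0 , λ _ _ _ _ →
    subst (ℚ._< ε) (sym (cong ℚ.∣_∣ (ℚₚ.+-inverseʳ q))) 0<ε

  +-cauchy : ∀ f g → IsCauchy f → IsCauchy g → IsCauchy (λ n → f n ℚ.+ g n)
  +-cauchy f g cf cg ε 0<ε with split 1ℚ 1ℚ ε 0<1 0<1 0<ε
  ... | δ , 0<δ , eq with cf δ 0<δ | cg δ 0<δ
  ... | N₁ , near₁ | N₂ , near₂ = N₁ ℕ.⊔ N₂ , near
    where
    δ+δ≡ε : δ ℚ.+ δ ≡ ε
    δ+δ≡ε = trans (sym (cong₂ ℚ._+_ (ℚₚ.*-identityˡ δ) (ℚₚ.*-identityˡ δ))) eq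

    near : ∀ m n → N₁ ℕ.⊔ N₂ ℕ.≤ m → N₁ ℕ.⊔ N₂ ℕ.≤ n →
           ℚ.∣ (f m ℚ.+ g m) ℚ.- (f n ℚ.+ g n) ∣ ℚ.< ε
    near m n N≤m N≤n =
      subst (λ q → ℚ.∣ q ∣ ℚ.< ε) (sym (+-rearrange (f m) (g m) (f n) (g n)))
      (subst (ℚ.∣ (f m ℚ.- f n) ℚ.+ (g m ℚ.- g n) ∣ ℚ.<_) δ+δ≡ε
        (∣+∣-bound (f m ℚ.- f n) (g m ℚ.- g n)
          (near₁ m n (ℕₚ.m⊔n≤o⇒m≤o N₁ N₂ N≤m) (ℕₚ.m⊔n≤o⇒m≤o N₁ N₂ N≤n))
          (near₂ m n (ℕₚ.m⊔n≤o⇒n≤o N₁ N₂ N≤m) (ℕₚ.m⊔n≤o⇒n≤o N₁ N₂ N≤n))))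

  eventually-bounded : ∀ f → IsCauchy f →
    ∃[ K ] (0ℚ ℚ.< K) × ∃[ N ] ∀ n → N ℕ.≤ n → ℚ.∣ f n ∣ ℚ.< K
  eventually-bounded f cf with cf 1ℚ 0<1
  ... | N , near = K , ℚₚ.+-mono-<-≤ 0<1 (ℚₚ.0≤∣p∣ (f N)) , N , bound
    where
    K : ℚ
    K = 1ℚ ℚ.+ ℚ.∣ f N ∣

    bound : ∀ n → N ℕ.≤ n → ℚ.∣ f n ∣ ℚ.< K
    bound n N≤n = subst (λ q → ℚ.∣ q ∣ ℚ.< K) (sym (+-add-back (f n) (f N)))
      (ℚₚ.≤-<-trans (ℚₚ.∣p+q∣≤∣p∣+∣q∣ (f n ℚ.- f N) (f N))
        (ℚₚ.+-monoˡ-< ℚ.∣ f N ∣ (near n N N≤n ℕₚ.≤-refl)))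

  *-cauchy : ∀ f g → IsCauchy f → IsCauchy g → IsCauchy (λ n → f n ℚ.* g n)
  *-cauchy f g cf cg ε 0<ε =
    let K₁ , 0<K₁ , M₁ , bound₁ = eventually-bounded f cf
        K₂ , 0<K₂ , M₂ , bound₂ = eventually-bounded g cg
        δ , 0<δ , eq            = split K₁ K₂ ε 0<K₁ 0<K₂ 0<ε
        N₁ , near₁              = cf δ 0<δ
        N₂ , near₂              = cg δ 0<δ
        M                       = M₁ ℕ.⊔ M₂
        N                       = N₁ ℕ.⊔ N₂
    in M ℕ.⊔ N , λ m n ≤m ≤n →
      let M≤m = ℕₚ.m⊔n≤o⇒m≤o M N ≤m
          M≤n = ℕₚ.m⊔n≤o⇒m≤o M N ≤n
          N≤m = ℕₚ.m⊔n≤o⇒n≤o M N ≤m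
          N≤n = ℕₚ.m⊔n≤o⇒n≤o M N ≤n
      in subst (ℚ.∣ f m ℚ.* g m ℚ.- f n ℚ.* g n ∣ ℚ.<_) eq
           (*-near {f m} {g m} {f n} {g n} {K₁} {K₂} {δ} 0<K₁ 0<K₂
             (bound₁ m (ℕₚ.m⊔n≤o⇒m≤o M₁ M₂ M≤m))
             (bound₂ n (ℕₚ.m⊔n≤o⇒n≤o M₁ M₂ M≤n))
             (near₁ m n (ℕₚ.m⊔n≤o⇒m≤o N₁ N₂ N≤m) (ℕₚ.m⊔n≤o⇒m≤o N₁ N₂ N≤n))
             (near₂ m n (ℕₚ.m⊔n≤o⇒n≤o N₁ N₂ N≤m) (ℕₚ.m⊔n≤o⇒n≤o N₁ N₂ N≤n)))

fromℚ : ℚ → ℝ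
fromℚ q = mkℝ (λ _ → q) (const-cauchy q)

0ℝ 1ℝ : ℝ
0ℝ = fromℚ 0ℚ
1ℝ = fromℚ 1ℚ

infixl 6 _+_
_+_ : ℝ → ℝ → ℝ
x + y = mkℝ (λ n → seq x n ℚ.+ seq y n) (+-cauchy (seq x) (seq y) (cauchy x) (cauchy y))

infixl 7 _*_
_*_ : ℝ → ℝ → ℝ
x * y = mkℝ (λ n → seq x n ℚ.* seq y n) (*-cauchy (seq x) (seq y) (cauchy x) (cauchy y))

+-rawMonoid : RawMonoid 0ℓ 0ℓ
+-rawMonoid = record { Carrier = ℝ ; _≈_ = _≈_ ; _∙_ = _+_ ; ε = 0ℝ }

open RawSum +-rawMonoid public using (sum)

------------------------------------------------------------------------
-- Square real matrices

Vector : ℕ → Set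
Vector n = Fin n → ℝ

Matrix : ℕ → Set
Matrix n = Fin n → Fin n → ℝ

infix 4 _≈ᵥ_ _≈ₘ_
_≈ᵥ_ : Rel (Vector n) 0ℓ
u ≈ᵥ v = ∀ i → u i ≈ v i

_≈ₘ_ : Rel (Matrix n) 0ℓ
A ≈ₘ B = ∀ i j → A i j ≈ B i j

0ᵥ : Vector n
0ᵥ _ = 0ℝ

O : Matrix n
O _ _ = 0ℝ

I : Matrix n
I i j with i ≟ j
... | yes _ = 1ℝ
... | no  _ = 0ℝ

infixl 7 _·_ _·ᵥ_ _⊙_
_·_ : Matrix n → Matrix n → Matrix n
(A · B) i j = sum λ l → A i l * B l j

_·ᵥ_ : Matrix n → Vector n → Vector n
(A ·ᵥ v) i = sum λ l → A i l * v l

_⊙_ : Matrix n → Matrix n → Matrix n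
(A ⊙ B) i j = A i j * B i j

Symmetric : Matrix n → Set
Symmetric A = ∀ i j → A i j ≈ A j i

linearCombination : (Fin k → ℝ) → (Fin k → Vector n) → Vector n
linearCombination c b i = sum λ t → c t * b t i

LinearlyIndependent : (Fin k → Vector n) → Set
LinearlyIndependent b = ∀ c → linearCombination c b ≈ᵥ 0ᵥ → ∀ t → c t ≈ 0ℝ

record IsKernelBasis (A : Matrix n) (b : Fin k → Vector n) : Set where
  field
    inKernel    : ∀ t → A ·ᵥ b t ≈ᵥ 0ᵥ
    independent : LinearlyIndependent b
    spanning    : ∀ v → A ·ᵥ v ≈ᵥ 0ᵥ → ∃[ c ] v ≈ᵥ linearCombination c b

-- "null(A) = k".  A relation, because reals have no decidable equality and so
-- the dimension of a kernel is not computable from the matrix.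
HasNullity : Matrix n → ℕ → Set
HasNullity {n} A k = Σ[ b ∈ (Fin k → Vector n) ] IsKernelBasis A b

SAP : Matrix n → Set
SAP A = ∀ X → Symmetric X → A ⊙ X ≈ₘ O → I ⊙ X ≈ₘ O → A · X ≈ₘ O → X ≈ₘ O

------------------------------------------------------------------------
-- Graphs

record Graph (n : ℕ) : Set₁ where
  field
    Adj    : Rel (Fin n) 0ℓ
    adj?   : B.Decidable Adj
    symm   : B.Symmetric Adj
    irrefl : ∀ {i} → ¬ Adj i i

open Graph public

complement : Graph n → Graph n
complement G = record
  { Adj    = λ i j → i ≢ j × ¬ Adj G i j
  ; adj?   = λ i j → ¬? (i ≟ j) ×-dec ¬? (adj? G i j)
  ; symm   = λ (i≢j , ¬ij) → i≢j ∘ sym , ¬ij ∘ symm G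
  ; irrefl = λ (i≢i , _) → i≢i refl
  }

NonEdge : Graph n → Rel (Fin n) 0ℓ
NonEdge G = Adj (complement G)

record _∈𝒮_ (A : Matrix n) (G : Graph n) : Set where
  field
    symmetric : Symmetric A
    nonzero   : ∀ {i j} → Adj G i j → ¬ (A i j ≈ 0ℝ)
    zeros     : ∀ {i j} → i ≢ j → ¬ Adj G i j → A i j ≈ 0ℝ

Induced : Pred (Fin n) 0ℓ → Rel (Fin n) 0ℓ → Rel (Fin n) 0ℓ
Induced S E u v = S u × S v × E u v

-- C is a connected component of the subgraph of (Fin n , E) induced on S.
record IsComponent (S : Pred (Fin n) 0ℓ) (E : Rel (Fin n) 0ℓ) (C : Subset n) : Set where
  field
    nonempty : Nonempty C
    within   : ∀ {u} → u ∈ C → S u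
    closure  : ∀ {u v} → u ∈ C → (v ∈ C ⇔ Star (Induced S E) u v)

CyclicNext : Rel (Fin k) 0ℓ
CyclicNext {k} s t = toℕ t ≡ suc (toℕ s) ⊎ (suc (toℕ s) ≡ k × toℕ t ≡ 0)

-- The subgraph of (Fin n , E) induced on C is a cycle of length k, whose
-- vertices in cyclic order are listed by `vertex`.
record IsCycle (E : Rel (Fin n) 0ℓ) (C : Subset n) (k : ℕ) : Set where
  field
    length≥3  : 3 ℕ.≤ k
    vertex    : Fin k → Fin n
    injective : Injective _≡_ _≡_ vertex
    image     : ∀ {v} → v ∈ C ⇔ (∃[ t ] vertex t ≡ v)
    edges     : ∀ {s t} → E (vertex s) (vertex t) ⇔ (CyclicNext s t ⊎ CyclicNext t s)

------------------------------------------------------------------------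
-- The SAP color change rule

-- A set of blue non-edges, as a symmetric relation; every set reached from
-- `cl G B` below is symmetric and contained in NonEdge G.
BlueSet : ℕ → Set₁
BlueSet n = Rel (Fin n) 0ℓ

White : Graph n → BlueSet n → Rel (Fin n) 0ℓ
White G E u v = NonEdge G u v × ¬ E u v

φ : Graph n → BlueSet n → Fin n → Pred (Fin n) 0ℓ
φ G E k u = (u ≡ k ⊎ Adj G k u) ⊎ E u k

-- i → j in the zero forcing game on G whose set of blue vertices is S.
record Forces (G : Graph n) (S : Pred (Fin n) 0ℓ) (i j : Fin n) : Set where
  field
    blue     : S i
    neighbor : Adj G i j
    white    : ¬ S j
    unique   : ∀ {l} → Adj G i l → ¬ S l → l ≡ j

addPair : BlueSet n → Fin n → Fin n → BlueSet n
addPair E j k u v = E u v ⊎ ((u ≡ j × v ≡ k) ⊎ (u ≡ k × v ≡ j))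

-- A component is identified with its vertex set C; as it is an induced
-- subgraph of the white graph, its edges are the white non-edges inside C.
addWhiteWithin : Graph n → BlueSet n → Subset n → BlueSet n
addWhiteWithin G E C u v = E u v ⊎ (u ∈ C × v ∈ C × White G E u v)

-- One application of the color change rule, under the restriction on
-- forcing triples imposed by B.
data Step (G : Graph n) (B : Subset n) (E : BlueSet n) : BlueSet n → Set where
  triple   : ∀ k i j → White G E j k → Forces G (φ G E k) i j →
             ¬ (i ∈ B × NonEdge G i k) →
             Step G B E (addPair E j k)
  oddCycle : ∀ i C ℓ → IsComponent (Adj G i) (White G E) C →
             IsCycle (White G E) C ℓ → ¬ (2 ∣ ℓ) →
             Step G B E (addWhiteWithin G E C)

cl : Graph n → Subset n → BlueSet n
cl G B u v = NonEdge G u v × (u ∈ B ⊎ v ∈ B)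

IsZvcSet : Graph n → Subset n → Set₁
IsZvcSet G B =
  ∃[ E ] Star (Step G B) (cl G B) E × (∀ u v → NonEdge G u v → E u v)

------------------------------------------------------------------------
-- The parameters M, ξ and Z_vc, each given as the relation "the value is m":
-- the maxima over real matrices exist classically but are not computed here.

IsMaximum IsMinimum : Pred ℕ a → ℕ → Set a
IsMaximum P m = P m × (∀ k → P k → k ℕ.≤ m)
IsMinimum P m = P m × (∀ k → P k → m ℕ.≤ k)

IsM : Graph n → ℕ → Set
IsM {n} G = IsMaximum λ k →
  Σ[ A ∈ Matrix n ] A ∈𝒮 G × HasNullity A k

Isξ : Graph n → ℕ → Set
Isξ {n} G = IsMaximum λ k →
  Σ[ A ∈ Matrix n ] A ∈𝒮 G × SAP A × HasNullity A k

IsZvc : Graph n → ℕ → Set₁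
IsZvc {n} G = IsMinimum λ k →
  Σ[ B ∈ Subset n ] ∣ B ∣ ≡ k × IsZvcSet G B

{-# OPTIONS --safe #-}

-- The conclusion is decidable and _≈_ on ℝ is ¬¬-stable, so the argument may
-- use excluded middle as long as it stays under a double negation.
--
-- Start with A of nullity M(G) and a Z_vc-set B, and treat the vertices b of B
-- one after another.  If some kernel vector v has v b ≠ 0, add 1 to the
-- diagonal entry at b: for w in the new kernel, 0 = vᵀ(A + E_bb)w = v b * w b,
-- so the new kernel consists of the old kernel vectors vanishing at b, and the
-- nullity drops by one.  In the end the nullity is at least M(G) - |B| and
-- every kernel vector vanishes on B.  The columns of a matrix X as in the SAP
-- are kernel vectors, so X vanishes on cl(B), and every color change extends
-- the vanishing: for a forcing triple (k : i → j) the entry (AX)_ik reduces to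
-- A_ij X_jk, and around an odd cycle in N(i) the weights A_is A_it X_st
-- alternate in sign.
module Submission where

open import Defs hiding (_+_; _*_)
open import Data.Nat.Base using (ℕ)
open import Data.Integer.Base using (+_; _-_; _≤_)

import Defs as D
open import Algebra.Bundles using (CommutativeRing)
open import Data.Fin.Base using (Fin; zero; suc; punchIn; punchOut; toℕ; fromℕ; fromℕ<)
open import Data.Fin.Properties using (_≟_; punchInᵢ≢i; punchIn-punchOut; punchIn-injective; toℕ-injective; toℕ-fromℕ; toℕ-fromℕ<; toℕ<n)
open import Data.Fin.Subset using (Subset; inside; outside; _∈_; ∣_∣)
import Data.Integer.Base as ℤ
import Data.Integer.Properties as ℤₚ
open import Data.List.Base using (List; []; _∷_; length; map)
open import Data.List.Membership.Propositional using () renaming (_∈_ to _∈ₗ_)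
open import Data.List.Membership.Propositional.Properties using (∈-map⁺)
open import Data.List.Properties using (length-map)
open import Data.List.Relation.Unary.All as All using (All; []; _∷_)
import Data.List.Relation.Unary.Any as Any
open import Data.Nat.Base as ℕ using (suc; zero)
open import Data.Nat.Divisibility using (_∣_; ∣-refl; ∣m∣n⇒∣m+n)
import Data.Nat.Properties as ℕₚ
open import Data.Product.Base using (∃-syntax; _×_; _,_; proj₁; proj₂)
open import Data.Rational.Base as ℚ using (ℚ; 0ℚ; 1ℚ; ½)
import Data.Rational.Properties as ℚₚ
open import Data.Rational.Solver using (module +-*-Solver)
open import Data.Sum.Base using (_⊎_; inj₁; inj₂; [_,_])
open import Data.Vec.Base using ([]; _∷_; here; there)
open import Data.Vec.Functional using (insertAt)
open import Data.Vec.Functional.Properties using (insertAt-lookup; insertAt-punchIn)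
open import Function.Base using (_∘_)
open import Function.Bundles using (Equivalence)
open import Level using (0ℓ)
open import Relation.Binary.Construct.Closure.ReflexiveTransitive using (Star; _◅_) renaming (ε to done)
open import Relation.Binary.PropositionalEquality using (_≡_; _≢_; refl; sym; trans; cong; cong₂; subst; subst₂)
open import Relation.Binary.Structures using (IsEquivalence)
open import Relation.Nullary.Decidable using (yes; no; decidable-stable; ¬¬-excluded-middle)
open import Relation.Nullary.Negation using (¬_; contradiction)

-- Real numbers

halve : ∀ ε → 0ℚ ℚ.< ε → ∃[ δ ] 0ℚ ℚ.< δ × δ ℚ.+ δ ≡ ε
halve ε 0<ε = ½ ℚ.* ε , 0<½ε ,
  trans (sym (ℚₚ.*-distribʳ-+ ε ½ ½)) (ℚₚ.*-identityˡ ε)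
  where
  0<½ε : 0ℚ ℚ.< ½ ℚ.* ε
  0<½ε = subst (ℚ._< ½ ℚ.* ε) (ℚₚ.*-zeroʳ ½) (ℚₚ.*-monoʳ-<-pos ½ 0<ε)

∣p-r∣≤∣p-q∣+∣q-r∣ : ∀ p q r → ℚ.∣ p ℚ.- r ∣ ℚ.≤ ℚ.∣ p ℚ.- q ∣ ℚ.+ ℚ.∣ q ℚ.- r ∣
∣p-r∣≤∣p-q∣+∣q-r∣ p q r =
  subst (λ t → ℚ.∣ t ∣ ℚ.≤ ℚ.∣ p ℚ.- q ∣ ℚ.+ ℚ.∣ q ℚ.- r ∣) (telescope p q r) (ℚₚ.∣p+q∣≤∣p∣+∣q∣ (p ℚ.- q) (q ℚ.- r))
  where
  telescope : ∀ a b c → (a ℚ.- b) ℚ.+ (b ℚ.- c) ≡ a ℚ.- c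
  telescope = solve 3 (λ a b c → (a :- b) :+ (b :- c) := a :- c) refl
    where open +-*-Solver

∣p-q∣≡∣q-p∣ : ∀ p q → ℚ.∣ p ℚ.- q ∣ ≡ ℚ.∣ q ℚ.- p ∣
∣p-q∣≡∣q-p∣ p q = trans (sym (ℚₚ.∣-p∣≡∣p∣ (p ℚ.- q))) (cong ℚ.∣_∣ (negate p q))
  where
  negate : ∀ a b → ℚ.- (a ℚ.- b) ≡ b ℚ.- a
  negate = solve 2 (λ a b → :- (a :- b) := b :- a) refl
    where open +-*-Solver

∣p∣<q+∣r∣ : ∀ p r {q} → ℚ.∣ p ℚ.- r ∣ ℚ.< q → ℚ.∣ p ∣ ℚ.< q ℚ.+ ℚ.∣ r ∣
∣p∣<q+∣r∣ p r near = ℚₚ.≤-<-trans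
  (subst (λ t → ℚ.∣ t ∣ ℚ.≤ ℚ.∣ p ℚ.- r ∣ ℚ.+ ℚ.∣ r ∣) (rejoin p r) (ℚₚ.∣p+q∣≤∣p∣+∣q∣ (p ℚ.- r) r))
  (ℚₚ.+-monoˡ-< ℚ.∣ r ∣ near)
  where
  rejoin : ∀ a b → (a ℚ.- b) ℚ.+ b ≡ a
  rejoin = solve 2 (λ a b → (a :- b) :+ b := a) refl
    where open +-*-Solver

∣p*q∣<r*s : ∀ p q {r s} → ℚ.∣ p ∣ ℚ.< r → ℚ.∣ q ∣ ℚ.≤ s → 0ℚ ℚ.< s →
            ℚ.∣ p ℚ.* q ∣ ℚ.< r ℚ.* s
∣p*q∣<r*s p q {r} {s} p<r q≤s 0<s = subst (ℚ._< r ℚ.* s) (sym (ℚₚ.∣p*q∣≡∣p∣*∣q∣ p q))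
  (ℚₚ.≤-<-trans
    (ℚₚ.*-monoˡ-≤-nonNeg ℚ.∣ p ∣ {{ℚₚ.∣-∣-nonNeg p}} q≤s)
    (ℚₚ.*-monoˡ-<-pos s {{ℚ.positive 0<s}} p<r))

divide : ∀ ε s → 0ℚ ℚ.< ε → 0ℚ ℚ.< s → ∃[ δ ] 0ℚ ℚ.< δ × δ ℚ.* s ≡ ε
divide ε s 0<ε 0<s = ε ℚ.* s⁻¹ ,
  subst (ℚ._< ε ℚ.* s⁻¹) (ℚₚ.*-zeroˡ s⁻¹) (ℚₚ.*-monoˡ-<-pos s⁻¹ {{ℚₚ.1/pos⇒pos s}} 0<ε) ,
  trans (ℚₚ.*-assoc ε s⁻¹ s) (trans (cong (ε ℚ.*_) (ℚₚ.*-inverseˡ s)) (ℚₚ.*-identityʳ ε))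
  where
  instance
    s-pos : ℚ.Positive s
    s-pos = ℚ.positive 0<s
    s-nonZero : ℚ.NonZero s
    s-nonZero = ℚₚ.pos⇒nonZero s
  s⁻¹ : ℚ
  s⁻¹ = ℚ.1/ s

0<1 : 0ℚ ℚ.< 1ℚ
0<1 = ℚₚ.positive⁻¹ 1ℚ

eventually≡⇒≈ : ∀ {x y} N → (∀ n → N ℕ.≤ n → seq x n ≡ seq y n) → x ≈ y
eventually≡⇒≈ {x} {y} N x≡y = mk≈ λ ε 0<ε → N , λ n N≤n →
  subst (λ q → ℚ.∣ seq x n ℚ.- q ∣ ℚ.< ε) (x≡y n N≤n)
    (subst (ℚ._< ε) (sym (cong ℚ.∣_∣ (ℚₚ.+-inverseʳ (seq x n)))) 0<ε)

≗⇒≈ : ∀ {x y} → (∀ n → seq x n ≡ seq y n) → x ≈ y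
≗⇒≈ x≗y = eventually≡⇒≈ 0 λ n _ → x≗y n

≈-sym : ∀ {x y} → x ≈ y → y ≈ x
≈-sym {x} {y} x≈y = mk≈ λ ε 0<ε → let N , near = close x≈y ε 0<ε in
  N , λ n N≤n → subst (ℚ._< ε) (∣p-q∣≡∣q-p∣ (seq x n) (seq y n)) (near n N≤n)

≈-trans : ∀ {x y z} → x ≈ y → y ≈ z → x ≈ z
≈-trans {x} {y} {z} x≈y y≈z = mk≈ λ ε 0<ε →
  let δ , 0<δ , δ+δ≡ε = halve ε 0<ε
      M , nearₘ       = close x≈y δ 0<δ
      N , nearₙ       = close y≈z δ 0<δ
  in M ℕ.⊔ N , λ n ≤n → subst (ℚ.∣ seq x n ℚ.- seq z n ∣ ℚ.<_) δ+δ≡ε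
       (ℚₚ.≤-<-trans (∣p-r∣≤∣p-q∣+∣q-r∣ (seq x n) (seq y n) (seq z n))
         (ℚₚ.+-mono-< (nearₘ n (ℕₚ.m⊔n≤o⇒m≤o M N ≤n)) (nearₙ n (ℕₚ.m⊔n≤o⇒n≤o M N ≤n))))

≈-isEquivalence : IsEquivalence _≈_
≈-isEquivalence = record { refl = ≗⇒≈ λ _ → refl ; sym = ≈-sym ; trans = ≈-trans }

+-congʳ : ∀ x {y z} → y ≈ z → y D.+ x ≈ z D.+ x
+-congʳ x {y} {z} y≈z = mk≈ λ ε 0<ε → let N , near = close y≈z ε 0<ε in
  N , λ n N≤n → subst (λ q → ℚ.∣ q ∣ ℚ.< ε) (cancel (seq x n) (seq y n) (seq z n)) (near n N≤n)
  where
  cancel : ∀ a b c → b ℚ.- c ≡ (b ℚ.+ a) ℚ.- (c ℚ.+ a)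
  cancel = solve 3 (λ a b c → b :- c := (b :+ a) :- (c :+ a)) refl
    where open +-*-Solver

*-congʳ : ∀ x {y z} → y ≈ z → y D.* x ≈ z D.* x
*-congʳ x {y} {z} y≈z = mk≈ λ ε 0<ε →
  let K , 0<K , M , bounded = eventually-bounded (seq x) (cauchy x)
      δ , 0<δ , δK≡ε        = divide ε K 0<ε 0<K
      N , near              = close y≈z δ 0<δ
  in M ℕ.⊔ N , λ n ≤n →
       subst (λ q → ℚ.∣ q ∣ ℚ.< ε) (factor (seq x n) (seq y n) (seq z n))
         (subst (ℚ.∣ (seq y n ℚ.- seq z n) ℚ.* seq x n ∣ ℚ.<_) δK≡ε
           (∣p*q∣<r*s (seq y n ℚ.- seq z n) (seq x n)
             (near n (ℕₚ.m⊔n≤o⇒n≤o M N ≤n))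
             (ℚₚ.<⇒≤ (bounded n (ℕₚ.m⊔n≤o⇒m≤o M N ≤n))) 0<K))
  where
  factor : ∀ a b c → (b ℚ.- c) ℚ.* a ≡ b ℚ.* a ℚ.- c ℚ.* a
  factor = solve 3 (λ a b c → (b :- c) :* a := b :* a :- c :* a) refl
    where open +-*-Solver

+-comm : ∀ x y → x D.+ y ≈ y D.+ x
+-comm x y = ≗⇒≈ λ n → ℚₚ.+-comm (seq x n) (seq y n)

*-comm : ∀ x y → x D.* y ≈ y D.* x
*-comm x y = ≗⇒≈ λ n → ℚₚ.*-comm (seq x n) (seq y n)

ℝ-commutativeRing : CommutativeRing 0ℓ 0ℓ
ℝ-commutativeRing = record
  { Carrier = ℝ
  ; _≈_ = _≈_
  ; _+_ = D._+_
  ; _*_ = D._*_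
  -- Negation is multiplication by the constant -1, so `*-cauchy` already supplies its modulus.
  ; -_ = λ x → fromℚ (ℚ.- 1ℚ) D.* x
  ; 0# = 0ℝ
  ; 1# = 1ℝ
  ; isCommutativeRing = record
    { isRing = record
      { +-isAbelianGroup = record
        { isGroup = record
          { isMonoid = record
            { isSemigroup = record
              { isMagma = record
                { isEquivalence = ≈-isEquivalence
                ; ∙-cong = λ {x} {y} {u} {v} x≈y u≈v → ≈-trans (+-congʳ u x≈y)
                    (≈-trans (+-comm y u) (≈-trans (+-congʳ y u≈v) (+-comm v y)))
                }
              ; assoc = λ x y z → ≗⇒≈ λ n → ℚₚ.+-assoc (seq x n) (seq y n) (seq z n)
              }
            ; identity = (λ x → ≗⇒≈ λ n → ℚₚ.+-identityˡ (seq x n))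
                       , (λ x → ≗⇒≈ λ n → ℚₚ.+-identityʳ (seq x n))
            }
          ; inverse = (λ x → ≗⇒≈ λ n → negationˡ (seq x n))
                    , (λ x → ≗⇒≈ λ n → negationʳ (seq x n))
          ; ⁻¹-cong = λ {x} {y} x≈y → ≈-trans (*-comm _ x)
              (≈-trans (*-congʳ (fromℚ (ℚ.- 1ℚ)) x≈y) (*-comm y _))
          }
        ; comm = +-comm
        }
      ; *-cong = λ {x} {y} {u} {v} x≈y u≈v → ≈-trans (*-congʳ u x≈y)
          (≈-trans (*-comm y u) (≈-trans (*-congʳ y u≈v) (*-comm v y)))
      ; *-assoc = λ x y z → ≗⇒≈ λ n → ℚₚ.*-assoc (seq x n) (seq y n) (seq z n)
      ; *-identity = (λ x → ≗⇒≈ λ n → ℚₚ.*-identityˡ (seq x n))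
                   , (λ x → ≗⇒≈ λ n → ℚₚ.*-identityʳ (seq x n))
      ; distrib = (λ x y z → ≗⇒≈ λ n → ℚₚ.*-distribˡ-+ (seq x n) (seq y n) (seq z n))
                , (λ x y z → ≗⇒≈ λ n → ℚₚ.*-distribʳ-+ (seq x n) (seq y n) (seq z n))
      }
    ; *-comm = *-comm
    }
  }
  where
  open +-*-Solver
  negationˡ : ∀ a → (ℚ.- 1ℚ) ℚ.* a ℚ.+ a ≡ 0ℚ
  negationˡ = solve 1 (λ a → con (ℚ.- 1ℚ) :* a :+ a := con 0ℚ) refl
  negationʳ : ∀ a → a ℚ.+ (ℚ.- 1ℚ) ℚ.* a ≡ 0ℚ
  negationʳ = solve 1 (λ a → a :+ con (ℚ.- 1ℚ) :* a := con 0ℚ) refl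

-- Stability of equality and inversion of nonzero reals.

≈0-intro : ∀ x → (∀ ε → 0ℚ ℚ.< ε → ∃[ N ] ∀ n → N ℕ.≤ n → ℚ.∣ seq x n ∣ ℚ.< ε) → x ≈ 0ℝ
≈0-intro x small = mk≈ λ ε 0<ε → let N , near = small ε 0<ε in
  N , λ n N≤n → subst (λ q → ℚ.∣ q ∣ ℚ.< ε) (sym (ℚₚ.+-identityʳ (seq x n))) (near n N≤n)

≈0-elim : ∀ {x} → x ≈ 0ℝ → ∀ ε → 0ℚ ℚ.< ε → ∃[ N ] ∀ n → N ℕ.≤ n → ℚ.∣ seq x n ∣ ℚ.< ε
≈0-elim {x} x≈0 ε 0<ε = let N , near = close x≈0 ε 0<ε in
  N , λ n N≤n → subst (λ q → ℚ.∣ q ∣ ℚ.< ε) (ℚₚ.+-identityʳ (seq x n)) (near n N≤n)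

-- Only one rational comparison has to escape the double negation. With `N` a modulus for ε/4, the
-- claim that the single term at `N` has absolute value below ε/2 is decidable, hence stable, and
-- the Cauchy condition carries it to all later terms.
≈0-stable : ∀ {x} → ¬ ¬ x ≈ 0ℝ → x ≈ 0ℝ
≈0-stable {x} ¬¬x≈0 = ≈0-intro x λ ε 0<ε →
  let δ , 0<δ , δ+δ≡ε = halve ε 0<ε
      η , 0<η , η+η≡δ = halve δ 0<δ
      N , near        = cauchy x η 0<η
      ∣xN∣<δ = decidable-stable (ℚ.∣ seq x N ∣ ℚₚ.<? δ) λ ≮δ → ¬¬x≈0 λ x≈0 →
        let M , small = ≈0-elim x≈0 η 0<η
            n         = M ℕ.⊔ N
        in ≮δ (subst (ℚ.∣ seq x N ∣ ℚ.<_) η+η≡δ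
             (ℚₚ.<-trans (∣p∣<q+∣r∣ (seq x N) (seq x n) (near N n ℕₚ.≤-refl (ℕₚ.m≤n⊔m M N)))
               (ℚₚ.+-monoʳ-< η (small n (ℕₚ.m≤m⊔n M N)))))
      η≤δ = η+η≡δ⇒η≤δ η+η≡δ (ℚₚ.<⇒≤ 0<η)
  in N , λ n N≤n → subst (ℚ.∣ seq x n ∣ ℚ.<_) δ+δ≡ε
       (ℚₚ.<-trans (∣p∣<q+∣r∣ (seq x n) (seq x N) (near n N N≤n ℕₚ.≤-refl))
         (ℚₚ.+-mono-≤-< η≤δ ∣xN∣<δ))
  where
  η+η≡δ⇒η≤δ : ∀ {η δ} → η ℚ.+ η ≡ δ → 0ℚ ℚ.≤ η → η ℚ.≤ δ
  η+η≡δ⇒η≤δ {η} η+η≡δ 0≤η = subst (η ℚ.≤_) η+η≡δ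
    (subst (ℚ._≤ η ℚ.+ η) (ℚₚ.+-identityʳ η) (ℚₚ.+-monoʳ-≤ η 0≤η))

open CommutativeRing ℝ-commutativeRing
  using (_+_; _*_; -_; setoid; semiring; ring; reflexive; +-cong; +-congˡ; +-assoc; +-identityˡ;
         +-identityʳ; -‿cong; -‿inverseˡ; -‿inverseʳ; *-congˡ; *-assoc; *-identityˡ; zeroˡ; zeroʳ;
         distribˡ)
  renaming (refl to ≈-refl)
open import Algebra.Properties.Ring ring using (-‿distribˡ-*; -‿distribʳ-*; -‿involutive)
open import Algebra.Properties.Semiring.Sum semiring using (sum-cong-≋; sum-remove; ∑-distrib-+; ∑-comm; *-distribˡ-sum; *-distribʳ-sum; sum-replicate-zero)

≈-stable : ∀ {x y} → ¬ ¬ x ≈ y → x ≈ y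
≈-stable {x} {y} ¬¬x≈y = ≈-trans x≈x+-y+y (≈-trans (+-congʳ y x+-y≈0) (+-identityˡ y))
  where
  x+-y≈0 : x + - y ≈ 0ℝ
  x+-y≈0 = ≈0-stable λ x+-y≉0 → ¬¬x≈y λ x≈y →
    x+-y≉0 (≈-trans (+-congʳ (- y) x≈y) (-‿inverseʳ y))
  x≈x+-y+y : x ≈ x + - y + y
  x≈x+-y+y = ≈-sym (≈-trans (+-assoc x (- y) y)
    (≈-trans (+-congˡ {x} (-‿inverseˡ y)) (+-identityʳ x)))

-- Extended by 0⁻¹ = 0.
recip : ℚ → ℚ
recip q with q ℚₚ.≟ 0ℚ
... | yes _   = 0ℚ
... | no q≢0 = ℚ.1/_ q {{ℚ.≢-nonZero q≢0}}

*-recip : ∀ {q} → q ≢ 0ℚ → q ℚ.* recip q ≡ 1ℚ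
*-recip {q} q≢0 with q ℚₚ.≟ 0ℚ
... | yes q≡0 = contradiction q≡0 q≢0
... | no q≢0  = ℚₚ.*-inverseʳ q {{ℚ.≢-nonZero q≢0}}

-- Constructive apartness from zero: it carries the rational bound that a modulus for the inverse
-- needs, which a bare refutation of `x ≈ 0ℝ` does not give.
BoundedAway : ℝ → Set
BoundedAway x = ∃[ ε ] 0ℚ ℚ.< ε × ∃[ N ] ∀ n → N ℕ.≤ n → ε ℚ.≤ ℚ.∣ seq x n ∣

-- The inverse is taken termwise; terms before `N` may be zero, so `recip` has to be total and the
-- product equals 1 only from `N` on. Since 1/a - 1/b = (b - a)(1/a)(1/b) and late reciprocals are
-- bounded by `K` = 1/ε, a modulus of `x` at η/K² serves at η.
boundedAway⇒invertible : ∀ x → BoundedAway x → ∃[ y ] x * y ≈ 1ℝ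
boundedAway⇒invertible x (ε , 0<ε , N , away) = y , eventually≡⇒≈ N λ n N≤n → *-recip (x≢0 n N≤n)
  where
  x≢0 : ∀ n → N ℕ.≤ n → seq x n ≢ 0ℚ
  x≢0 n N≤n x≡0 = ℚₚ.<-irrefl refl
    (ℚₚ.<-≤-trans 0<ε (subst (λ q → ε ℚ.≤ ℚ.∣ q ∣) x≡0 (away n N≤n)))

  r : ℕ → ℚ
  r n = recip (seq x n)

  bound : ∃[ K ] 0ℚ ℚ.< K × K ℚ.* ε ≡ 1ℚ
  bound = divide 1ℚ ε 0<1 0<ε

  K : ℚ
  K = proj₁ bound

  0<K : 0ℚ ℚ.< K
  0<K = proj₁ (proj₂ bound)

  ∣r∣≤K : ∀ n → N ℕ.≤ n → ℚ.∣ r n ∣ ℚ.≤ K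
  ∣r∣≤K n N≤n = ℚₚ.*-cancelʳ-≤-pos ε {{ℚ.positive 0<ε}} (begin
    ℚ.∣ r n ∣ ℚ.* ε                ≤⟨ ℚₚ.*-monoˡ-≤-nonNeg ℚ.∣ r n ∣ {{ℚₚ.∣-∣-nonNeg (r n)}} (away n N≤n) ⟩
    ℚ.∣ r n ∣ ℚ.* ℚ.∣ seq x n ∣    ≡⟨ ℚₚ.∣p*q∣≡∣p∣*∣q∣ (r n) (seq x n) ⟨
    ℚ.∣ r n ℚ.* seq x n ∣          ≡⟨ cong ℚ.∣_∣ (trans (ℚₚ.*-comm (r n) (seq x n)) (*-recip (x≢0 n N≤n))) ⟩
    1ℚ                             ≡⟨ proj₂ (proj₂ bound) ⟨
    K ℚ.* ε                        ∎)
    where open ℚₚ.≤-Reasoning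

  recip-difference : ∀ m n → N ℕ.≤ m → N ℕ.≤ n →
                     ((seq x n ℚ.- seq x m) ℚ.* r m) ℚ.* r n ≡ r m ℚ.- r n
  recip-difference m n N≤m N≤n = trans
    (expand (seq x m) (seq x n) (r m) (r n))
    (trans (cong₂ (λ p q → p ℚ.* r m ℚ.- q ℚ.* r n) (*-recip (x≢0 n N≤n)) (*-recip (x≢0 m N≤m)))
      (cong₂ ℚ._-_ (ℚₚ.*-identityˡ (r m)) (ℚₚ.*-identityˡ (r n))))
    where
    expand : ∀ a b c d → ((b ℚ.- a) ℚ.* c) ℚ.* d ≡ b ℚ.* d ℚ.* c ℚ.- a ℚ.* c ℚ.* d
    expand = solve 4 (λ a b c d → ((b :- a) :* c) :* d := b :* d :* c :- a :* c :* d) refl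
      where open +-*-Solver

  abstract
    r-cauchy : IsCauchy r
    r-cauchy η 0<η =
      let ζ , 0<ζ , ζK≡η = divide η K 0<η 0<K
          δ , 0<δ , δK≡ζ = divide ζ K 0<ζ 0<K
          M , near       = cauchy x δ 0<δ
      in M ℕ.⊔ N , λ m n ≤m ≤n →
        let N≤m = ℕₚ.m⊔n≤o⇒n≤o M N ≤m
            N≤n = ℕₚ.m⊔n≤o⇒n≤o M N ≤n
            d   = seq x n ℚ.- seq x m
        in subst (λ q → ℚ.∣ q ∣ ℚ.< η) (recip-difference m n N≤m N≤n)
             (subst (ℚ.∣ d ℚ.* r m ℚ.* r n ∣ ℚ.<_) ζK≡η
               (∣p*q∣<r*s (d ℚ.* r m) (r n)
                 (subst (ℚ.∣ d ℚ.* r m ∣ ℚ.<_) δK≡ζ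
                   (∣p*q∣<r*s d (r m) (near n m (ℕₚ.m⊔n≤o⇒m≤o M N ≤n) (ℕₚ.m⊔n≤o⇒m≤o M N ≤m))
                     (∣r∣≤K m N≤m) 0<K))
                 (∣r∣≤K n N≤n) 0<K))

  y : ℝ
  y = mkℝ r r-cauchy

-- If a term past the modulus for ε/2 had absolute value at least ε, the Cauchy condition would keep
-- all terms past that modulus at least ε/2 in absolute value.
¬boundedAway⇒≈0 : ∀ x → ¬ BoundedAway x → x ≈ 0ℝ
¬boundedAway⇒≈0 x ¬away = ≈0-intro x λ ε 0<ε →
  let δ , 0<δ , δ+δ≡ε = halve ε 0<ε
      N , near        = cauchy x δ 0<δ
  in N , λ n N≤n → decidable-stable (ℚ.∣ seq x n ∣ ℚₚ.<? ε) λ ≮ε →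
       ¬away (δ , 0<δ , N , λ m N≤m → ℚₚ.≮⇒≥ λ ∣xm∣<δ → ≮ε
         (subst (ℚ.∣ seq x n ∣ ℚ.<_) δ+δ≡ε
           (ℚₚ.<-trans (∣p∣<q+∣r∣ (seq x n) (seq x m) (near n m N≤n N≤m))
             (ℚₚ.+-monoʳ-< δ ∣xm∣<δ))))

≉0⇒invertible : ∀ x → ¬ x ≈ 0ℝ → ¬ ¬ (∃[ y ] x * y ≈ 1ℝ)
≉0⇒invertible x x≉0 none = x≉0 (¬boundedAway⇒≈0 x (none ∘ boundedAway⇒invertible x))


-- Linear algebra

open import Relation.Binary.Reasoning.Setoid setoid

private
  variable
    n k : ℕ


sum-cong : {f g : Vector n} → (∀ i → f i ≈ g i) → sum f ≈ sum g
sum-cong {f = f} {g} f≈g = sum-cong-≋ {x = f} {g} f≈g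

sum-zero : {f : Vector n} → (∀ i → f i ≈ 0ℝ) → sum f ≈ 0ℝ
sum-zero {n} f≈0 = ≈-trans (sum-cong f≈0) (sum-replicate-zero n)

sum-single : (f : Vector n) (i : Fin n) → (∀ j → j ≢ i → f j ≈ 0ℝ) → sum f ≈ f i
sum-single {suc n} f i f≈0 = begin
  sum f                         ≈⟨ sum-remove {i = i} f ⟩
  f i + sum (f ∘ punchIn i)     ≈⟨ +-congˡ (sum-zero λ j → f≈0 (punchIn i j) (punchInᵢ≢i i j)) ⟩
  f i + 0ℝ                      ≈⟨ +-identityʳ (f i) ⟩
  f i                           ∎

sum-pair : (f : Vector n) {i j : Fin n} → i ≢ j →
           (∀ l → l ≢ i → l ≢ j → f l ≈ 0ℝ) → sum f ≈ f i + f j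
sum-pair {suc n} f {i} {j} i≢j f≈0 = begin
  sum f                                 ≈⟨ sum-remove {i = i} f ⟩
  f i + sum (f ∘ punchIn i)             ≈⟨ +-congˡ (sum-single (f ∘ punchIn i) (punchOut i≢j) others) ⟩
  f i + f (punchIn i (punchOut i≢j))    ≡⟨ cong (λ l → f i + f l) (punchIn-punchOut i≢j) ⟩
  f i + f j                             ∎
  where
  others : ∀ l → l ≢ punchOut i≢j → f (punchIn i l) ≈ 0ℝ
  others l l≢ = f≈0 (punchIn i l) (punchInᵢ≢i i l) λ il≡j →
    l≢ (punchIn-injective i l (punchOut i≢j) (trans il≡j (sym (punchIn-punchOut i≢j))))

-- The inverse of `x` is available only under a double negation, but the conclusion is an equality
-- of reals and therefore stable.
≉0-*-cancel : ∀ {x y} → ¬ x ≈ 0ℝ → x * y ≈ 0ℝ → y ≈ 0ℝ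
≉0-*-cancel {x} {y} x≉0 xy≈0 = ≈-stable λ y≉0 → ≉0⇒invertible x x≉0 λ (z , xz≈1) → y≉0 (begin
  y             ≈⟨ *-identityˡ y ⟨
  1ℝ * y        ≈⟨ *-congʳ y xz≈1 ⟨
  x * z * y     ≈⟨ *-congʳ y (*-comm x z) ⟩
  z * x * y     ≈⟨ *-assoc z x y ⟩
  z * (x * y)   ≈⟨ *-congˡ {z} xy≈0 ⟩
  z * 0ℝ        ≈⟨ zeroʳ z ⟩
  0ℝ            ∎)

-- Kernels and diagonal increments.

Kernel : Matrix n → Vector n → Set
Kernel A v = A ·ᵥ v ≈ᵥ 0ᵥ

I-diagonal : (i : Fin n) → I i i ≈ 1ℝ
I-diagonal i with i ≟ i
... | yes _  = ≈-refl
... | no i≢i = contradiction refl i≢i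

I-offDiagonal : {i j : Fin n} → i ≢ j → I i j ≈ 0ℝ
I-offDiagonal {i = i} {j} i≢j with i ≟ j
... | yes i≡j = contradiction i≡j i≢j
... | no _    = ≈-refl

·ᵥ-linear : ∀ (A : Matrix n) u c w i →
            (A ·ᵥ λ j → u j + c * w j) i ≈ (A ·ᵥ u) i + c * (A ·ᵥ w) i
·ᵥ-linear A u c w i = begin
  (sum λ j → A i j * (u j + c * w j))
    ≈⟨ sum-cong (λ j → expand (A i j) (u j) c (w j)) ⟩
  (sum λ j → A i j * u j + c * (A i j * w j))
    ≈⟨ ∑-distrib-+ (λ j → A i j * u j) (λ j → c * (A i j * w j)) ⟩
  (A ·ᵥ u) i + (sum λ j → c * (A i j * w j))
    ≈⟨ +-congˡ {(A ·ᵥ u) i} (*-distribˡ-sum c (λ j → A i j * w j)) ⟨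
  (A ·ᵥ u) i + c * (A ·ᵥ w) i ∎
  where
  expand : ∀ x y z w → x * (y + z * w) ≈ x * y + z * (x * w)
  expand x y z w = ≗⇒≈ λ m → solve 4
    (λ x y z w → x :* (y :+ z :* w) := x :* y :+ z :* (x :* w)) refl
    (seq x m) (seq y m) (seq z m) (seq w m)
    where open +-*-Solver

-- Exchanging the two sums and using symmetry moves `A` from `w` to `v`, where it gives zero.
kernel-orthogonal-range : ∀ {A : Matrix n} {v} → Symmetric A → Kernel A v →
                          ∀ w → (sum λ i → v i * (A ·ᵥ w) i) ≈ 0ℝ
kernel-orthogonal-range {A = A} {v} A-symmetric Av≈0 w = begin
  (sum λ i → v i * (A ·ᵥ w) i)
    ≈⟨ sum-cong (λ i → *-distribˡ-sum (v i) (λ j → A i j * w j)) ⟩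
  (sum λ i → sum λ j → v i * (A i j * w j))
    ≈⟨ ∑-comm (λ i j → v i * (A i j * w j)) ⟩
  (sum λ j → sum λ i → v i * (A i j * w j))
    ≈⟨ sum-cong (λ j → sum-cong λ i → transpose i j) ⟩
  (sum λ j → sum λ i → A j i * v i * w j)
    ≈⟨ sum-cong (λ j → *-distribʳ-sum (w j) (λ i → A j i * v i)) ⟨
  (sum λ j → (A ·ᵥ v) j * w j)
    ≈⟨ sum-zero (λ j → ≈-trans (*-congʳ (w j) (Av≈0 j)) (zeroˡ (w j))) ⟩
  0ℝ ∎
  where
  transpose : ∀ i j → v i * (A i j * w j) ≈ A j i * v i * w j
  transpose i j = begin
    v i * (A i j * w j)   ≈⟨ *-assoc (v i) (A i j) (w j) ⟨
    v i * A i j * w j     ≈⟨ *-congʳ (w j) (*-comm (v i) (A i j)) ⟩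
    A i j * v i * w j     ≈⟨ *-congʳ (w j) (*-congʳ (v i) (A-symmetric i j)) ⟩
    A j i * v i * w j     ∎

-- The increment is written as the rank-one matrix e eᵀ, with e the unit vector `I b`, so that its
-- action on `v` factors as `v b` times e by plain sum manipulation.
incrementDiagonal : Matrix n → Fin n → Matrix n
incrementDiagonal A b i j = A i j + I b i * I b j

incrementDiagonal-·ᵥ : ∀ (A : Matrix n) b v i →
                       (incrementDiagonal A b ·ᵥ v) i ≈ (A ·ᵥ v) i + I b i * v b
incrementDiagonal-·ᵥ A b v i = begin
  (sum λ j → (A i j + I b i * I b j) * v j)
    ≈⟨ sum-cong (λ j → expand (A i j) (I b i) (I b j) (v j)) ⟩
  (sum λ j → A i j * v j + I b i * (I b j * v j))
    ≈⟨ ∑-distrib-+ (λ j → A i j * v j) (λ j → I b i * (I b j * v j)) ⟩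
  (A ·ᵥ v) i + (sum λ j → I b i * (I b j * v j))
    ≈⟨ +-congˡ {(A ·ᵥ v) i} (*-distribˡ-sum (I b i) (λ j → I b j * v j)) ⟨
  (A ·ᵥ v) i + I b i * (sum λ j → I b j * v j)
    ≈⟨ +-congˡ {(A ·ᵥ v) i} (*-congˡ {I b i} (sum-single (λ j → I b j * v j) b λ j j≢b →
         ≈-trans (*-congʳ (v j) (I-offDiagonal (j≢b ∘ sym))) (zeroˡ (v j)))) ⟩
  (A ·ᵥ v) i + I b i * (I b b * v b)
    ≈⟨ +-congˡ {(A ·ᵥ v) i} (*-congˡ {I b i} (≈-trans (*-congʳ (v b) (I-diagonal b)) (*-identityˡ (v b)))) ⟩
  (A ·ᵥ v) i + I b i * v b ∎
  where
  expand : ∀ x y z w → (x + y * z) * w ≈ x * w + y * (z * w)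
  expand x y z w = ≗⇒≈ λ m → solve 4
    (λ x y z w → (x :+ y :* z) :* w := x :* w :+ y :* (z :* w)) refl
    (seq x m) (seq y m) (seq z m) (seq w m)
    where open +-*-Solver

incrementDiagonal-offDiagonal : ∀ (A : Matrix n) b {i j} → i ≢ j →
                                incrementDiagonal A b i j ≈ A i j
incrementDiagonal-offDiagonal A b {i} {j} i≢j = begin
  A i j + I b i * I b j   ≈⟨ +-congˡ {A i j} vanishes ⟩
  A i j + 0ℝ              ≈⟨ +-identityʳ (A i j) ⟩
  A i j                   ∎
  where
  vanishes : I b i * I b j ≈ 0ℝ
  vanishes with b ≟ i
  ... | yes refl = ≈-trans (*-congˡ {1ℝ} (I-offDiagonal i≢j)) (zeroʳ 1ℝ)
  ... | no _     = zeroˡ (I b j)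

incrementDiagonal-∈𝒮 : ∀ {G : Graph n} {A : Matrix n} b → A ∈𝒮 G → incrementDiagonal A b ∈𝒮 G
incrementDiagonal-∈𝒮 {G = G} {A} b A∈𝒮 = record
  { symmetric = λ i j → +-cong (symmetric i j) (*-comm (I b i) (I b j))
  ; nonzero   = λ {i} {j} ij A′≈0 → nonzero ij
      (≈-trans (≈-sym (incrementDiagonal-offDiagonal A b (adjacent⇒≢ ij))) A′≈0)
  ; zeros     = λ i≢j ¬ij → ≈-trans (incrementDiagonal-offDiagonal A b i≢j) (zeros i≢j ¬ij)
  }
  where
  open _∈𝒮_ A∈𝒮
  adjacent⇒≢ : ∀ {i j} → Adj G i j → i ≢ j
  adjacent⇒≢ ij refl = irrefl G ij

-- Pairing the equation for `w` with `v` kills the contribution of `A` by orthogonality and leaves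
-- `v b * w b ≈ 0ℝ`. Once `w b` is zero, the increment acts on `w` as zero.
kernel-incrementDiagonal : ∀ {A : Matrix n} {b v} → Symmetric A → Kernel A v → ¬ v b ≈ 0ℝ →
                           ∀ w → Kernel (incrementDiagonal A b) w → Kernel A w × w b ≈ 0ℝ
kernel-incrementDiagonal {n} {A} {b} {v} A-symmetric Av≈0 vb≉0 w A′w≈0 = Aw≈0 , wb≈0
  where
  wb≈0 : w b ≈ 0ℝ
  wb≈0 = ≉0-*-cancel vb≉0 (begin
    v b * w b
      ≈⟨ *-congˡ {v b} (≈-trans (*-congʳ (w b) (I-diagonal b)) (*-identityˡ (w b))) ⟨
    v b * (I b b * w b)
      ≈⟨ sum-single (λ i → v i * (I b i * w b)) b (λ j j≢b → ≈-trans
           (*-congˡ {v j} (≈-trans (*-congʳ (w b) (I-offDiagonal (j≢b ∘ sym))) (zeroˡ (w b))))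
           (zeroʳ (v j))) ⟨
    (sum λ i → v i * (I b i * w b))
      ≈⟨ +-identityˡ _ ⟨
    0ℝ + (sum λ i → v i * (I b i * w b))
      ≈⟨ +-congʳ _ (kernel-orthogonal-range A-symmetric Av≈0 w) ⟨
    (sum λ i → v i * (A ·ᵥ w) i) + (sum λ i → v i * (I b i * w b))
      ≈⟨ ∑-distrib-+ (λ i → v i * (A ·ᵥ w) i) (λ i → v i * (I b i * w b)) ⟨
    (sum λ i → v i * (A ·ᵥ w) i + v i * (I b i * w b))
      ≈⟨ sum-zero (λ i → begin
           v i * (A ·ᵥ w) i + v i * (I b i * w b)  ≈⟨ distribˡ (v i) ((A ·ᵥ w) i) (I b i * w b) ⟨
           v i * ((A ·ᵥ w) i + I b i * w b)        ≈⟨ *-congˡ {v i} (incrementDiagonal-·ᵥ A b w i) ⟨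
           v i * (incrementDiagonal A b ·ᵥ w) i    ≈⟨ *-congˡ {v i} (A′w≈0 i) ⟩
           v i * 0ℝ                                ≈⟨ zeroʳ (v i) ⟩
           0ℝ                                      ∎) ⟩
    0ℝ ∎)

  Aw≈0 : Kernel A w
  Aw≈0 i = begin
    (A ·ᵥ w) i                        ≈⟨ +-identityʳ _ ⟨
    (A ·ᵥ w) i + 0ℝ                   ≈⟨ +-congˡ {(A ·ᵥ w) i} (zeroʳ (I b i)) ⟨
    (A ·ᵥ w) i + I b i * 0ℝ           ≈⟨ +-congˡ {(A ·ᵥ w) i} (*-congˡ {I b i} wb≈0) ⟨
    (A ·ᵥ w) i + I b i * w b          ≈⟨ incrementDiagonal-·ᵥ A b w i ⟨
    (incrementDiagonal A b ·ᵥ w) i    ≈⟨ A′w≈0 i ⟩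
    0ℝ                                ∎

-- One step of Gaussian elimination with pivot `p = basis s b`. The scalar `r` stands for -1/p,
-- given by an equation instead of a division, so `basis′` subtracts from each remaining basis
-- vector the multiple of `basis s` that cancels its entry at `b`.
module Elimination {A : Matrix n} {basis : Fin (suc k) → Vector n} (isBasis : IsKernelBasis A basis)
  (b : Fin n) (s : Fin (suc k)) (r : ℝ) (pr+1≈0 : basis s b * r + 1ℝ ≈ 0ℝ) where

  open IsKernelBasis isBasis

  A′ : Matrix n
  A′ = incrementDiagonal A b

  p : ℝ
  p = basis s b

  q : Fin k → ℝ
  q t = basis (punchIn s t) b

  basis′ : Fin k → Vector n
  basis′ t i = basis (punchIn s t) i + q t * r * basis s i

  combination-split : ∀ (d : Vector (suc k)) i → linearCombination d basis i ≈
                      d s * basis s i + linearCombination (d ∘ punchIn s) (basis ∘ punchIn s) i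
  combination-split d i = sum-remove {i = s} λ t → d t * basis t i

  combination-basis′ : ∀ (c : Vector k) i → linearCombination c basis′ i ≈
    (sum λ t → c t * q t) * r * basis s i + linearCombination c (basis ∘ punchIn s) i
  combination-basis′ c i = begin
    (sum λ t → c t * basis′ t i)
      ≈⟨ sum-cong (λ t → expand (c t) (basis (punchIn s t) i) (q t) r (basis s i)) ⟩
    (sum λ t → c t * q t * (r * basis s i) + c t * basis (punchIn s t) i)
      ≈⟨ ∑-distrib-+ (λ t → c t * q t * (r * basis s i)) (λ t → c t * basis (punchIn s t) i) ⟩
    (sum λ t → c t * q t * (r * basis s i)) + L
      ≈⟨ +-congʳ L (*-distribʳ-sum (r * basis s i) (λ t → c t * q t)) ⟨
    Q * (r * basis s i) + L
      ≈⟨ +-congʳ L (*-assoc Q r (basis s i)) ⟨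
    Q * r * basis s i + L ∎
    where
    Q L : ℝ
    Q = sum λ t → c t * q t
    L = linearCombination c (basis ∘ punchIn s) i
    expand : ∀ v w x y z → v * (w + x * y * z) ≈ v * x * (y * z) + v * w
    expand v w x y z = ≗⇒≈ λ m → solve 5
      (λ v w x y z → v :* (w :+ x :* y :* z) := v :* x :* (y :* z) :+ v :* w) refl
      (seq v m) (seq w m) (seq x m) (seq y m) (seq z m)
      where open +-*-Solver

  basis′-vanishes : ∀ t → basis′ t b ≈ 0ℝ
  basis′-vanishes t = begin
    q t + q t * r * p      ≈⟨ factor (q t) r p ⟩
    q t * (p * r + 1ℝ)     ≈⟨ *-congˡ {q t} pr+1≈0 ⟩
    q t * 0ℝ               ≈⟨ zeroʳ (q t) ⟩
    0ℝ                     ∎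
    where
    factor : ∀ x y z → x + x * y * z ≈ x * (z * y + 1ℝ)
    factor x y z = ≗⇒≈ λ m → solve 3
      (λ x y z → x :+ x :* y :* z := x :* (z :* y :+ con 1ℚ)) refl
      (seq x m) (seq y m) (seq z m)
      where open +-*-Solver

  inKernel′ : ∀ t → Kernel A′ (basis′ t)
  inKernel′ t i = begin
    (A′ ·ᵥ basis′ t) i
      ≈⟨ incrementDiagonal-·ᵥ A b (basis′ t) i ⟩
    (A ·ᵥ basis′ t) i + I b i * basis′ t b
      ≈⟨ +-cong (·ᵥ-linear A (basis (punchIn s t)) (q t * r) (basis s) i)
           (≈-trans (*-congˡ {I b i} (basis′-vanishes t)) (zeroʳ (I b i))) ⟩
    (A ·ᵥ basis (punchIn s t)) i + q t * r * (A ·ᵥ basis s) i + 0ℝ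
      ≈⟨ +-identityʳ _ ⟩
    (A ·ᵥ basis (punchIn s t)) i + q t * r * (A ·ᵥ basis s) i
      ≈⟨ +-cong (inKernel (punchIn s t) i)
           (≈-trans (*-congˡ {q t * r} (inKernel s i)) (zeroʳ (q t * r))) ⟩
    0ℝ + 0ℝ
      ≈⟨ +-identityˡ 0ℝ ⟩
    0ℝ ∎

  independent′ : LinearlyIndependent basis′
  independent′ c c·basis′≈0 t = begin
    c t              ≡⟨ insertAt-punchIn c s _ t ⟨
    d (punchIn s t)  ≈⟨ independent d d·basis≈0 (punchIn s t) ⟩
    0ℝ               ∎
    where
    Qr : ℝ
    Qr = (sum λ t → c t * q t) * r
    d : Vector (suc k)
    -- By `combination-basis′`, a combination of `basis′` with coefficients `c` is one of `basis`
    -- with the same coefficients off `s` and total coefficient `Qr` on the pivot vector.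
    d = insertAt c s Qr
    d·basis≈0 : linearCombination d basis ≈ᵥ 0ᵥ
    d·basis≈0 i = begin
      linearCombination d basis i
        ≈⟨ combination-split d i ⟩
      d s * basis s i + linearCombination (d ∘ punchIn s) (basis ∘ punchIn s) i
        ≈⟨ +-cong (*-congʳ (basis s i) (reflexive (insertAt-lookup c s Qr)))
             (sum-cong λ t → *-congʳ (basis (punchIn s t) i) (reflexive (insertAt-punchIn c s Qr t))) ⟩
      Qr * basis s i + linearCombination c (basis ∘ punchIn s) i
        ≈⟨ combination-basis′ c i ⟨
      linearCombination c basis′ i
        ≈⟨ c·basis′≈0 i ⟩
      0ℝ ∎

  -- The pivot coefficient of a kernel vector that vanishes at `b` is determined by the others:
  -- evaluation at `b` gives `d s * p + Q ≈ 0ℝ`, so `d s` is `Q * r`, exactly the coefficient that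
  -- `basis′` produces.
  spanning′ : (∀ v → Kernel A′ v → Kernel A v × v b ≈ 0ℝ) →
              ∀ v → Kernel A′ v → ∃[ c ] v ≈ᵥ linearCombination c basis′
  spanning′ kernel⊆ v A′v≈0 with kernel⊆ v A′v≈0
  ... | Av≈0 , vb≈0 with spanning v Av≈0
  ... | d , v≈d·basis = c , λ i → begin
    v i
      ≈⟨ v≈d·basis i ⟩
    linearCombination d basis i
      ≈⟨ combination-split d i ⟩
    d s * basis s i + linearCombination c (basis ∘ punchIn s) i
      ≈⟨ +-congʳ _ (*-congʳ (basis s i) ds≈Qr) ⟩
    Q * r * basis s i + linearCombination c (basis ∘ punchIn s) i
      ≈⟨ combination-basis′ c i ⟨
    linearCombination c basis′ i ∎
    where
    c : Vector k
    c = d ∘ punchIn s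
    Q : ℝ
    Q = sum λ t → c t * q t
    dsp+Q≈0 : d s * p + Q ≈ 0ℝ
    dsp+Q≈0 = ≈-trans (≈-sym (≈-trans (v≈d·basis b) (combination-split d b))) vb≈0
    ds≈Qr : d s ≈ Q * r
    ds≈Qr = begin
      d s                                    ≈⟨ +-identityʳ (d s) ⟨
      d s + 0ℝ                               ≈⟨ +-congˡ {d s} (≈-trans (*-congʳ r dsp+Q≈0) (zeroˡ r)) ⟨
      d s + (d s * p + Q) * r                ≈⟨ regroup (d s) p Q r ⟩
      d s * (p * r + 1ℝ) + Q * r             ≈⟨ +-congʳ (Q * r) (≈-trans (*-congˡ {d s} pr+1≈0) (zeroʳ (d s))) ⟩
      0ℝ + Q * r                             ≈⟨ +-identityˡ (Q * r) ⟩
      Q * r                                  ∎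
      where
      regroup : ∀ w x y z → w + (w * x + y) * z ≈ w * (x * z + 1ℝ) + y * z
      regroup w x y z = ≗⇒≈ λ m → solve 4
        (λ w x y z → w :+ (w :* x :+ y) :* z := w :* (x :* z :+ con 1ℚ) :+ y :* z) refl
        (seq w m) (seq x m) (seq y m) (seq z m)
        where open +-*-Solver

-- Making kernel vectors vanish on a list of vertices.

record Pinned (G : Graph n) (A : Matrix n) (k : ℕ) (b : Fin n) : Set where
  field
    matrix     : Matrix n
    nullity    : ℕ
    matrix∈𝒮   : matrix ∈𝒮 G
    hasNullity : HasNullity matrix nullity
    bound      : k ℕ.≤ suc nullity
    -- Containment in the old kernel is what lets vanishing at previously treated vertices survive
    -- this change of matrix.
    kernel⊆    : ∀ v → Kernel matrix v → Kernel A v × v b ≈ 0ℝ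

pin : ∀ {G : Graph n} {A : Matrix n} → A ∈𝒮 G → HasNullity A k → ∀ b → ¬ ¬ Pinned G A k b
-- In nullity zero the spanning family is empty, so the combination at `b` is the empty sum, which
-- is `0ℝ` by computation.
pin {n} {zero} {G} {A} A∈𝒮 (basis , isBasis) b none = none (record
  { matrix = A ; nullity = 0 ; matrix∈𝒮 = A∈𝒮 ; hasNullity = basis , isBasis ; bound = ℕ.z≤n
  ; kernel⊆ = λ v Av≈0 → Av≈0 , proj₂ (IsKernelBasis.spanning isBasis v Av≈0) b })
pin {n} {suc k} {G} {A} A∈𝒮 (basis , isBasis) b none =
  -- Whether some basis vector is nonzero at `b` is undecidable for these reals; this case
  -- distinction is why the result is doubly negated.
  ¬¬-excluded-middle {A = ∃[ s ] ¬ basis s b ≈ 0ℝ} λ where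
    (yes (s , p≉0)) → ≉0⇒invertible (basis s b) p≉0 λ (r , pr≈1) →
      let kernel⊆ = kernel-incrementDiagonal {v = basis s}
            (_∈𝒮_.symmetric A∈𝒮) (IsKernelBasis.inKernel isBasis s) p≉0
          open Elimination isBasis b s (- r)
            (≈-trans (+-congʳ 1ℝ (≈-trans (≈-sym (-‿distribʳ-* (basis s b) r)) (-‿cong pr≈1)))
              (-‿inverseˡ 1ℝ))
      in none (record
        { matrix = A′ ; nullity = k ; matrix∈𝒮 = incrementDiagonal-∈𝒮 b A∈𝒮
        ; hasNullity = basis′ , record
            { inKernel = inKernel′ ; independent = independent′ ; spanning = spanning′ kernel⊆ }
        ; bound = ℕₚ.≤-refl ; kernel⊆ = kernel⊆ })
    -- Every basis vector is zero at `b`, hence so is the whole kernel, and `A` can stay as it is.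
    (no ∄) → none (record
      { matrix = A ; nullity = suc k ; matrix∈𝒮 = A∈𝒮 ; hasNullity = basis , isBasis
      ; bound = ℕₚ.n≤1+n (suc k)
      ; kernel⊆ = λ v Av≈0 → let c , v≈ = IsKernelBasis.spanning isBasis v Av≈0 in
          Av≈0 , ≈-trans (v≈ b) (sum-zero λ t → ≈-trans
            (*-congˡ {c t} (≈-stable λ bt≉0 → ∄ (t , bt≉0))) (zeroʳ (c t))) })

VanishesOn : Matrix n → List (Fin n) → Set
VanishesOn A bs = ∀ v → Kernel A v → All (λ b → v b ≈ 0ℝ) bs

record Reduced (G : Graph n) (k : ℕ) (bs : List (Fin n)) : Set where
  field
    matrix     : Matrix n
    nullity    : ℕ
    matrix∈𝒮   : matrix ∈𝒮 G
    hasNullity : HasNullity matrix nullity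
    bound      : k ℕ.≤ length bs ℕ.+ nullity
    vanishes   : VanishesOn matrix bs

reduce : ∀ {G : Graph n} {A : Matrix n} → A ∈𝒮 G → HasNullity A k → ∀ bs → ¬ ¬ Reduced G k bs
reduce {k = k} {A = A} A∈𝒮 hasNullity [] none = none (record
  { matrix = A ; nullity = k ; matrix∈𝒮 = A∈𝒮 ; hasNullity = hasNullity
  ; bound = ℕₚ.≤-refl ; vanishes = λ _ _ → [] })
reduce A∈𝒮 hasNullity (b ∷ bs) none = reduce A∈𝒮 hasNullity bs λ R →
  let module R = Reduced R in pin R.matrix∈𝒮 R.hasNullity b λ P →
  let module P = Pinned P in none (record
    { matrix = P.matrix ; nullity = P.nullity ; matrix∈𝒮 = P.matrix∈𝒮 ; hasNullity = P.hasNullity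
    ; bound = ℕₚ.≤-trans R.bound (ℕₚ.≤-trans (ℕₚ.+-monoʳ-≤ (length bs) P.bound)
        (ℕₚ.≤-reflexive (ℕₚ.+-suc (length bs) P.nullity)))
    ; vanishes = λ v Pv≈0 → let Rv≈0 , vb≈0 = P.kernel⊆ v Pv≈0 in vb≈0 ∷ R.vanishes v Rv≈0 })

elements : Subset n → List (Fin n)
elements []            = []
elements (inside ∷ p)  = zero ∷ map suc (elements p)
elements (outside ∷ p) = map suc (elements p)

length-elements : (p : Subset n) → length (elements p) ≡ ∣ p ∣
length-elements []            = refl
length-elements (inside ∷ p)  = cong suc (trans (length-map suc (elements p)) (length-elements p))
length-elements (outside ∷ p) = trans (length-map suc (elements p)) (length-elements p)

∈-elements : ∀ {p : Subset n} {i} → i ∈ p → i ∈ₗ elements p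
∈-elements {p = inside ∷ p}  here        = Any.here refl
∈-elements {p = inside ∷ p}  (there i∈p) = Any.there (∈-map⁺ suc (∈-elements i∈p))
∈-elements {p = outside ∷ p} (there i∈p) = ∈-map⁺ suc (∈-elements i∈p)

-- Cycles

cyclicNext-functional : {s t u : Fin k} → CyclicNext s t → CyclicNext s u → t ≡ u
cyclicNext-functional (inj₁ t≡1+s)       (inj₁ u≡1+s)       = toℕ-injective (trans t≡1+s (sym u≡1+s))
cyclicNext-functional (inj₂ (_ , t≡0))   (inj₂ (_ , u≡0))   = toℕ-injective (trans t≡0 (sym u≡0))
cyclicNext-functional {t = t} (inj₁ t≡1+s) (inj₂ (1+s≡k , _)) =
  contradiction (trans t≡1+s 1+s≡k) (ℕₚ.<⇒≢ (toℕ<n t))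
cyclicNext-functional {u = u} (inj₂ (1+s≡k , _)) (inj₁ u≡1+s) =
  contradiction (trans u≡1+s 1+s≡k) (ℕₚ.<⇒≢ (toℕ<n u))

cyclicNext-injective : {r s t : Fin k} → CyclicNext r t → CyclicNext s t → r ≡ s
cyclicNext-injective (inj₁ t≡1+r) (inj₁ t≡1+s) =
  toℕ-injective (ℕₚ.suc-injective (trans (sym t≡1+r) t≡1+s))
cyclicNext-injective (inj₂ (1+r≡k , _)) (inj₂ (1+s≡k , _)) =
  toℕ-injective (ℕₚ.suc-injective (trans 1+r≡k (sym 1+s≡k)))
cyclicNext-injective (inj₁ t≡1+r) (inj₂ (_ , t≡0)) = contradiction (trans (sym t≡0) t≡1+r) λ ()
cyclicNext-injective (inj₂ (_ , t≡0)) (inj₁ t≡1+s) = contradiction (trans (sym t≡0) t≡1+s) λ ()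

-- Two indices that follow each other must use the wrap-around, which leaves a cycle of length 1 or
-- 2. This keeps the two neighbors of a cycle vertex distinct.
cyclicNext-noTwoCycle : {s t : Fin k} → 3 ℕ.≤ k → CyclicNext s t → ¬ CyclicNext t s
cyclicNext-noTwoCycle 3≤k (inj₁ t≡1+s) (inj₁ s≡1+t) =
  ℕₚ.<-asym (ℕₚ.≤-reflexive (sym t≡1+s)) (ℕₚ.≤-reflexive (sym s≡1+t))
cyclicNext-noTwoCycle 3≤k (inj₁ t≡1+s) (inj₂ (1+t≡k , s≡0)) =
  ℕₚ.<⇒≢ 3≤k (trans (cong suc (sym (trans t≡1+s (cong suc s≡0)))) 1+t≡k)
cyclicNext-noTwoCycle 3≤k (inj₂ (1+s≡k , t≡0)) (inj₁ s≡1+t) =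
  ℕₚ.<⇒≢ 3≤k (trans (cong suc (sym (trans s≡1+t (cong suc t≡0)))) 1+s≡k)
cyclicNext-noTwoCycle 3≤k (inj₂ (1+s≡k , t≡0)) (inj₂ (_ , s≡0)) =
  ℕₚ.<⇒≢ (ℕₚ.<-trans (ℕₚ.n<1+n 1) 3≤k) (trans (cong suc (sym s≡0)) 1+s≡k)

alternating : ℕ → ℝ
alternating zero    = 1ℝ
alternating (suc j) = - alternating j

-- The index is shifted because the last edge of a cycle of length `suc j` has index `j`: odd length
-- means a positive sign there.
alternating-even : ∀ j → ¬ 2 ∣ suc j → alternating j ≈ 1ℝ
alternating-even 0             _      = ≈-refl
alternating-even 1             2∤2    = contradiction ∣-refl 2∤2
alternating-even (suc (suc j)) 2∤3+j  = ≈-trans (-‿involutive (alternating j))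
  (alternating-even j λ 2∣1+j → 2∤3+j (∣m∣n⇒∣m+n ∣-refl 2∣1+j))

x+y≈0⇒y≈-x : ∀ {x y} → x + y ≈ 0ℝ → y ≈ - x
x+y≈0⇒y≈-x {x} {y} x+y≈0 = begin
  y               ≈⟨ +-identityˡ y ⟨
  0ℝ + y          ≈⟨ +-congʳ y (-‿inverseˡ x) ⟨
  - x + x + y     ≈⟨ +-assoc (- x) x y ⟩
  - x + (x + y)   ≈⟨ +-congˡ { - x } x+y≈0 ⟩
  - x + 0ℝ        ≈⟨ +-identityʳ (- x) ⟩
  - x             ∎

x+x≈0⇒x≈0 : ∀ {x} → x + x ≈ 0ℝ → x ≈ 0ℝ
x+x≈0⇒x≈0 {x} x+x≈0 = begin
  x                     ≈⟨ half x ⟩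
  fromℚ ½ * (x + x)     ≈⟨ *-congˡ {fromℚ ½} x+x≈0 ⟩
  fromℚ ½ * 0ℝ          ≈⟨ zeroʳ (fromℚ ½) ⟩
  0ℝ                    ∎
  where
  half : ∀ x → x ≈ fromℚ ½ * (x + x)
  half x = ≗⇒≈ λ m → solve 1 (λ x → x := con ½ :* (x :+ x)) refl (seq x m)
    where open +-*-Solver

-- Going once around an odd cycle flips the sign of an alternating edge weight.
oddCycle-weights-vanish : (z : Fin k → Fin k → ℝ) → 3 ℕ.≤ k → ¬ 2 ∣ k →
  (∀ {r s t} → CyclicNext r s → CyclicNext s t → z r s + z s t ≈ 0ℝ) →
  ∀ {s t} → CyclicNext s t → z s t ≈ 0ℝ
oddCycle-weights-vanish {1} _ (ℕ.s≤s ())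
oddCycle-weights-vanish {2} _ (ℕ.s≤s (ℕ.s≤s ()))
oddCycle-weights-vanish {k@(suc (suc (suc m)))} z 3≤k k-odd alternates {s} {t} st = begin
  z s t                            ≈⟨ signed (toℕ s) st refl ⟩
  alternating (toℕ s) * z₀         ≈⟨ *-congˡ {alternating (toℕ s)} z₀≈0 ⟩
  alternating (toℕ s) * 0ℝ         ≈⟨ zeroʳ (alternating (toℕ s)) ⟩
  0ℝ                               ∎
  where
  z₀ : ℝ
  z₀ = z zero (suc zero)

  01-next : CyclicNext {k} zero (suc zero)
  01-next = inj₁ refl

  signed : ∀ j {s t} → CyclicNext s t → toℕ s ≡ j → z s t ≈ alternating j * z₀
  signed zero {s} {t} st s≡0 with toℕ-injective {i = s} {zero} s≡0
  ... | refl with cyclicNext-functional st 01-next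
  ... | refl = ≈-sym (*-identityˡ z₀)
  signed (suc j) {s} {t} st s≡1+j = begin
    z s t                      ≈⟨ x+y≈0⇒y≈-x (alternates rs st) ⟩
    - z r s                    ≈⟨ -‿cong (signed j rs (toℕ-fromℕ< j<k)) ⟩
    - (alternating j * z₀)     ≈⟨ -‿distribˡ-* (alternating j) z₀ ⟩
    - alternating j * z₀       ∎
    where
    j<k : j ℕ.< k
    j<k = ℕₚ.<-trans (ℕₚ.≤-reflexive (sym s≡1+j)) (toℕ<n s)
    r : Fin k
    r = fromℕ< j<k
    rs : CyclicNext r s
    rs = inj₁ (trans s≡1+j (cong suc (sym (toℕ-fromℕ< j<k))))

  last : Fin k
  last = fromℕ (suc (suc m))

  last-0-next : CyclicNext last zero
  last-0-next = inj₂ (cong suc (toℕ-fromℕ (suc (suc m))) , refl)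

  z₀≈0 : z₀ ≈ 0ℝ
  z₀≈0 = x+x≈0⇒x≈0 (begin
    z₀ + z₀
      ≈⟨ +-congʳ z₀ (≈-trans (*-congʳ z₀ (alternating-even (suc (suc m)) k-odd)) (*-identityˡ z₀)) ⟨
    alternating (suc (suc m)) * z₀ + z₀
      ≈⟨ +-congʳ z₀ (signed (suc (suc m)) last-0-next (toℕ-fromℕ (suc (suc m)))) ⟨
    z last zero + z₀
      ≈⟨ alternates last-0-next 01-next ⟩
    0ℝ ∎)

-- Color changes preserve vanishing

module Forcing {G : Graph n} {A X : Matrix n} (A∈𝒮 : A ∈𝒮 G) (X-symmetric : Symmetric X)
  (A⊙X≈O : A ⊙ X ≈ₘ O) (I⊙X≈O : I ⊙ X ≈ₘ O) (AX≈O : A · X ≈ₘ O) where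

  open _∈𝒮_ A∈𝒮

  -- The invariant of the color change process: a blue non-edge certifies a zero entry of `X`.
  VanishesAt : BlueSet n → Set
  VanishesAt E = ∀ {u v} → E u v → X u v ≈ 0ℝ

  X-diagonal : ∀ u → X u u ≈ 0ℝ
  X-diagonal u = begin
    X u u           ≈⟨ *-identityˡ (X u u) ⟨
    1ℝ * X u u      ≈⟨ *-congʳ (X u u) (I-diagonal u) ⟨
    I u u * X u u   ≈⟨ I⊙X≈O u u ⟩
    0ℝ              ∎

  X-adjacent : ∀ {u v} → Adj G u v → X u v ≈ 0ℝ
  X-adjacent {u} {v} uv = ≉0-*-cancel (nonzero uv) (A⊙X≈O u v)

  X-flip : ∀ {u v} → X u v ≈ 0ℝ → X v u ≈ 0ℝ
  X-flip {u} {v} = ≈-trans (X-symmetric v u)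

  X-φ : ∀ {E k u} → VanishesAt E → φ G E k u → X u k ≈ 0ℝ
  X-φ vanish (inj₁ (inj₁ refl)) = X-diagonal _
  X-φ vanish (inj₁ (inj₂ ku))   = X-flip (X-adjacent ku)
  X-φ vanish (inj₂ uk)          = vanish uk

  -- Unless `l` is `i` or a neighbor of `i`, the entry of `A` is zero. The condition on neighbors is
  -- doubly negated so that it can be met by contradiction from a nonzero entry of `X`.
  term-vanishes : ∀ i l k → X i k ≈ 0ℝ → (Adj G i l → ¬ ¬ X l k ≈ 0ℝ) → A i l * X l k ≈ 0ℝ
  term-vanishes i l k Xik≈0 neighbour with i ≟ l | adj? G i l
  ... | yes refl | _      = ≈-trans (*-congˡ {A i i} Xik≈0) (zeroʳ (A i i))
  ... | no _     | yes il = ≈-trans (*-congˡ {A i l} (≈-stable (neighbour il))) (zeroʳ (A i l))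
  ... | no i≢l   | no ¬il = ≈-trans (*-congʳ (X l k) (zeros i≢l ¬il)) (zeroˡ (X l k))

  triple-vanishes : ∀ {E i j k} → VanishesAt E → Forces G (φ G E k) i j → X j k ≈ 0ℝ
  triple-vanishes {E} {i} {j} {k} vanish i→j = ≉0-*-cancel (nonzero neighbor) (begin
    A i j * X j k                  ≈⟨ sum-single (λ l → A i l * X l k) j others ⟨
    (sum λ l → A i l * X l k)      ≈⟨ AX≈O i k ⟩
    0ℝ                             ∎)
    where
    open Forces i→j
    others : ∀ l → l ≢ j → A i l * X l k ≈ 0ℝ
    -- A neighbor `l` of `i` with a nonzero entry `X l k` cannot be blue, so uniqueness of the white
    -- neighbor would identify it with `j`.
    others l l≢j = term-vanishes i l k (X-φ vanish blue) λ il Xlk≉0 →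
      l≢j (unique il (Xlk≉0 ∘ X-φ vanish))

  module OddCycle {E i C ℓ} (vanish : VanishesAt E) (component : IsComponent (Adj G i) (White G E) C)
    (cycle : IsCycle (White G E) C ℓ) (ℓ-odd : ¬ 2 ∣ ℓ) where

    open IsComponent component
    open IsCycle cycle

    vertex∈C : ∀ s → vertex s ∈ C
    vertex∈C s = Equivalence.from image (s , refl)

    i~ : ∀ s → Adj G i (vertex s)
    i~ s = within (vertex∈C s)

    a : Fin ℓ → ℝ
    a s = A i (vertex s)

    -- The factor `a s * a t` makes the weight symmetric in its two ends, so the equations at
    -- consecutive cycle vertices speak of the same edge weights.
    z : Fin ℓ → Fin ℓ → ℝ
    z s t = a s * a t * X (vertex s) (vertex t)

    -- The diagonal, the edges of `G` and the blue non-edges all carry zeros of `X`, so a nonzero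
    -- entry leaves only a white non-edge.
    white : ∀ {l s} → ¬ X l (vertex s) ≈ 0ℝ → White G E (vertex s) l
    white {l} {s} Xls≉0 = (s≢l , Xls≉0 ∘ X-flip ∘ X-adjacent) , Xls≉0 ∘ X-flip ∘ vanish
      where
      s≢l : vertex s ≢ l
      s≢l refl = Xls≉0 (X-diagonal l)

    -- Both ends of the white non-edge lie in N(i), so `l` belongs to the component `C`. As the
    -- white graph on `C` is an induced cycle, `l` must precede or follow `vertex s` on it.
    cycle-neighbour : ∀ {l s} → Adj G i l → ¬ X l (vertex s) ≈ 0ℝ →
                      ∃[ w ] vertex w ≡ l × (CyclicNext s w ⊎ CyclicNext w s)
    cycle-neighbour {l} {s} il Xls≉0 = w , w≡l ,
      Equivalence.to (edges {s} {w}) (subst (White G E (vertex s)) (sym w≡l) white-sl)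
      where
      white-sl : White G E (vertex s) l
      white-sl = white {l} {s} Xls≉0
      l∈C : l ∈ C
      l∈C = Equivalence.from (closure {vertex s} {l} (vertex∈C s)) ((i~ s , il , white-sl) ◅ done)
      listed : ∃[ w ] vertex w ≡ l
      listed = Equivalence.to (image {l}) l∈C
      w : Fin ℓ
      w = proj₁ listed
      w≡l : vertex w ≡ l
      w≡l = proj₂ listed

    -- This is the entry of `A · X` at row `i` and column `vertex s`: among the neighbors of `i`,
    -- only the two cycle neighbors of `vertex s` can have a nonzero entry in that column.
    row : ∀ {r s t} → CyclicNext r s → CyclicNext s t →
          a r * X (vertex r) (vertex s) + a t * X (vertex t) (vertex s) ≈ 0ℝ
    row {r} {s} {t} rs st = begin
      a r * X (vertex r) (vertex s) + a t * X (vertex t) (vertex s)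
        ≈⟨ sum-pair (λ l → A i l * X l (vertex s)) {vertex r} {vertex t} (r≢t ∘ injective) others ⟨
      (sum λ l → A i l * X l (vertex s))
        ≈⟨ AX≈O i (vertex s) ⟩
      0ℝ ∎
      where
      r≢t : r ≢ t
      r≢t refl = cyclicNext-noTwoCycle {s = r} {s} length≥3 rs st

      others : ∀ l → l ≢ vertex r → l ≢ vertex t → A i l * X l (vertex s) ≈ 0ℝ
      others l l≢r l≢t = term-vanishes i l (vertex s) (X-adjacent (i~ s)) λ il Xls≉0 →
        let w , w≡l , next = cycle-neighbour {l} {s} il Xls≉0 in
        [ (λ sw → l≢t (trans (sym w≡l) (cong vertex (cyclicNext-functional {s = s} {w} {t} sw st))))
        , (λ ws → l≢r (trans (sym w≡l) (cong vertex (cyclicNext-injective {r = w} {r} {s} ws rs))))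
        ] next

    alternates : ∀ {r s t} → CyclicNext r s → CyclicNext s t → z r s + z s t ≈ 0ℝ
    alternates {r} {s} {t} rs st = begin
      z r s + z s t
        ≈⟨ +-congˡ {z r s} (*-congˡ {a s * a t} (X-symmetric (vertex s) (vertex t))) ⟩
      a r * a s * Xrs + a s * a t * Xts
        ≈⟨ factor (a r) (a s) (a t) Xrs Xts ⟩
      a s * (a r * Xrs + a t * Xts)
        ≈⟨ *-congˡ {a s} (row rs st) ⟩
      a s * 0ℝ
        ≈⟨ zeroʳ (a s) ⟩
      0ℝ ∎
      where
      Xrs Xts : ℝ
      Xrs = X (vertex r) (vertex s)
      Xts = X (vertex t) (vertex s)
      factor : ∀ a b c x y → a * b * x + b * c * y ≈ b * (a * x + c * y)
      factor a b c x y = ≗⇒≈ λ m → solve 5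
        (λ a b c x y → a :* b :* x :+ b :* c :* y := b :* (a :* x :+ c :* y)) refl
        (seq a m) (seq b m) (seq c m) (seq x m) (seq y m)
        where open +-*-Solver

    -- The vertex `i` is adjacent to all of `C`, so both factors `a s` and `a t` are nonzero and
    -- cancel from the vanishing weight.
    X-next : ∀ {s t} → CyclicNext s t → X (vertex s) (vertex t) ≈ 0ℝ
    X-next {s} {t} st = ≉0-*-cancel {a t} {Xst} (nonzero (i~ t))
      (≉0-*-cancel {a s} {a t * Xst} (nonzero (i~ s)) (≈-trans
        (≈-sym (*-assoc (a s) (a t) Xst))
        (oddCycle-weights-vanish z length≥3 ℓ-odd alternates st)))
      where
      Xst : ℝ
      Xst = X (vertex s) (vertex t)

    X-white : ∀ {u v} → u ∈ C → v ∈ C → White G E u v → X u v ≈ 0ℝ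
    X-white u∈C v∈C uv with Equivalence.to image u∈C | Equivalence.to image v∈C
    ... | s , refl | t , refl = [ X-next , X-flip ∘ X-next ] (Equivalence.to edges uv)

  step-vanishes : ∀ {B E E′} → Step G B E E′ → VanishesAt E → VanishesAt E′
  step-vanishes (triple k i j _ i→j _) vanish (inj₁ uv) = vanish uv
  step-vanishes (triple k i j _ i→j _) vanish (inj₂ (inj₁ (refl , refl))) = triple-vanishes vanish i→j
  step-vanishes (triple k i j _ i→j _) vanish (inj₂ (inj₂ (refl , refl))) =
    X-flip (triple-vanishes vanish i→j)
  step-vanishes (oddCycle i C ℓ comp cyc odd) vanish (inj₁ uv) = vanish uv
  step-vanishes (oddCycle i C ℓ comp cyc odd) vanish (inj₂ (u∈C , v∈C , uv)) =
    OddCycle.X-white vanish comp cyc odd u∈C v∈C uv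

  steps-vanish : ∀ {B E E′} → Star (Step G B) E E′ → VanishesAt E → VanishesAt E′
  steps-vanish done           vanish = vanish
  steps-vanish (step ◅ steps) vanish = steps-vanish steps (step-vanishes step vanish)

  -- Each column of `X` is a kernel vector of `A`, hence zero at `B`; symmetry covers the non-edges
  -- whose second end lies in `B`.
  vanishesOn⇒cl : ∀ {B} → VanishesOn A (elements B) → VanishesAt (cl G B)
  vanishesOn⇒cl vanish {u} {v} (_ , inj₁ u∈B) =
    All.lookup (vanish (λ l → X l v) (λ i → AX≈O i v)) (∈-elements u∈B)
  vanishesOn⇒cl vanish {u} {v} (_ , inj₂ v∈B) =
    X-flip (All.lookup (vanish (λ l → X l u) (λ i → AX≈O i u)) (∈-elements v∈B))

  zvcSet⇒X≈O : ∀ {B} → VanishesOn A (elements B) → IsZvcSet G B → X ≈ₘ O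
  zvcSet⇒X≈O vanish (E , steps , complete) u v with u ≟ v | adj? G u v
  ... | yes refl | _      = X-diagonal u
  ... | no _     | yes uv = X-adjacent uv
  ... | no u≢v   | no ¬uv = steps-vanish steps (vanishesOn⇒cl vanish) (complete u v (u≢v , ¬uv))

-- The Strong Arnold Property and the inequality.

zvcSet⇒SAP : ∀ {G : Graph n} {A : Matrix n} {B} → A ∈𝒮 G → VanishesOn A (elements B) →
             IsZvcSet G B → SAP A
zvcSet⇒SAP A∈𝒮 vanish zvc X X-symmetric A⊙X I⊙X AX =
  Forcing.zvcSet⇒X≈O A∈𝒮 X-symmetric A⊙X I⊙X AX vanish zvc

m≤z+x⇒m-z≤x : ∀ m z x → m ℕ.≤ z ℕ.+ x → + m - + z ≤ + x
m≤z+x⇒m-z≤x m z x m≤z+x = subst₂ _≤_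
  (sym (ℤₚ.m-n≡m⊖n m z))
  (trans (ℤₚ.⊖-≥ (ℕₚ.m≤m+n z x)) (cong +_ (ℕₚ.m+n∸m≡n z x)))
  (ℤₚ.⊖-monoˡ-≤ z m≤z+x)

theorem3p2 : ∀ {n : ℕ} (G : Graph n) (m z x : ℕ) → IsM G m → IsZvc G z → Isξ G x → + m - + z ≤ + x
theorem3p2 G m z x ((A , A∈𝒮 , nullA) , _) ((B , refl , zvc) , _) (_ , x-max) =
  -- The order on integers is decidable, so the double negation around `reduce` is discharged here.
  decidable-stable (+ m - + z ℤₚ.≤? + x) λ m-z≰x → reduce A∈𝒮 nullA (elements B) λ R →
  let open Reduced R
      -- The reduced matrix has the SAP, so its nullity competes in the maximum defining ξ.
      nullity≤x = x-max nullity (matrix , matrix∈𝒮 , zvcSet⇒SAP matrix∈𝒮 vanishes zvc , hasNullity)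
      m≤z+x = ℕₚ.≤-trans bound (ℕₚ.+-mono-≤ (ℕₚ.≤-reflexive (length-elements B)) nullity≤x)
  in m-z≰x (m≤z+x⇒m-z≤x m z x m≤z+x)
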